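{- Let $G\in\mathcal F_6$. If $G$ admits a skew partition, then $G$ admits a balanced skew partition.
   Context: Graphs are finite and simple; Berge: all holes (induced cycles of length $\ge4$) and antiholes (induced subgraphs whose complement is a hole) are even. Paths are induced subgraphs that are paths; antipaths induced subgraphs whose complement is a path. A prism consists of two vertex-disjoint triangles $\{a_1,a_2,a_3\},\{b_1,b_2,b_3\}$ and paths $P_i$ from $a_i$ to $b_i$ with the only edges between $V(P_i),V(P_j)$ ($i\ne j$) being $a_ia_j,b_ib_j$; long if some $P_i$ has length $>1$. The double diamond: vertices $a_1..a_4,b_1..b_4$, every two $a_i$ adjacent except $a_3a_4$, every two $b_i$ adjacent except $b_3b_4$, $a_ib_i$ edges, no other edges. $\mathcal F_5$: Berge graphs $G$ such that for every bipartite subdivision $H$ of $K_4$ neither $G$ nor $\overline G$ has an induced subgraph isomorphic to $L(H)$, and neither $G$ nor $\overline G$ has an induced long prism. $\mathcal F_6$: graphs in $\mathcal F_5$ with no induced subgraph isomorphic to the double diamond. Skew partition: partition $(A,B)$ of $V(G)$ with $G|A$ disconnected and $\overline G|B$ disconnected; balanced if there is no odd path between nonadjacent vertices of $B$ with interior in $A$ and no odd antipath between adjacent vertices of $A$ with interior in $B$. -}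

module Defs where

open import Data.Bool using (Bool)
open import Data.Empty using (⊥)
open import Data.Fin using (Fin; zero; suc; toℕ; fromℕ; splitAt)
import Data.Fin as Fin
import Data.Fin.Properties as Fin
open import Data.Fin.Subset using (Subset; _∈_; _∪_; _∩_) renaming (⊤ to full; ⊥ to empty)
open import Data.List using (List; length; lookup; filter; allFin; cartesianProduct)
open import Data.Nat using (ℕ; suc; _<_; _≤_; _≟_)
open import Data.Nat.Divisibility using (_∣_)
open import Data.Product using (Σ; ∃; ∃₂; _×_; _,_; proj₁; proj₂)
open import Data.Sum using (_⊎_; inj₁; inj₂)
import Data.Sum as Sum
open import Data.Unit using (⊤; tt)
open import Function.Bundles using (_⇔_)
open import Function.Definitions using (Injective)
open import Relation.Binary using (Rel; Decidable; Symmetric; Irreflexive)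
open import Relation.Binary.Construct.Closure.ReflexiveTransitive using (Star)
open import Relation.Binary.PropositionalEquality using (_≡_; _≢_; refl; sym)
open import Relation.Nullary using (¬_; yes; no; ¬?; _×-dec_; _⊎-dec_)
open import Level using (0ℓ)

record Graph (n : ℕ) : Set₁ where
  infix 4 _∼_ _∼?_
  field
    _∼_      : Rel (Fin n) 0ℓ
    _∼?_     : Decidable _∼_
    ∼-sym    : Symmetric _∼_
    ∼-irrefl : Irreflexive _≡_ _∼_

-- The simple graph whose edges are the pairs of distinct vertices related by R
-- in at least one direction.
symmetrise : ∀ {n} (R : Rel (Fin n) 0ℓ) → Decidable R → Graph n
symmetrise R R? = record
  { _∼_      = λ x y → x ≢ y × (R x y ⊎ R y x)
  ; _∼?_     = λ x y → ¬? (x Fin.≟ y) ×-dec (R? x y ⊎-dec R? y x)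
  ; ∼-sym    = λ (x≢y , r) → (λ y≡x → x≢y (sym y≡x)) , Sum.swap r
  ; ∼-irrefl = λ x≡y (x≢y , _) → x≢y x≡y
  }

complement : ∀ {n} → Graph n → Graph n
complement G = record
  { _∼_      = λ x y → x ≢ y × ¬ (x ∼ y)
  ; _∼?_     = λ x y → ¬? (x Fin.≟ y) ×-dec ¬? (x ∼? y)
  ; ∼-sym    = λ (x≢y , x≁y) → (λ y≡x → x≢y (sym y≡x)) , λ y∼x → x≁y (∼-sym y∼x)
  ; ∼-irrefl = λ x≡y (x≢y , _) → x≢y x≡y
  }
  where open Graph G

-- H ⊑ G: an isomorphism from H onto an induced subgraph of G.
infix 4 _⊑_
record _⊑_ {m n} (H : Graph m) (G : Graph n) : Set where
  open Graph
  field
    embed     : Fin m → Fin n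
    injective : Injective _≡_ _≡_ embed
    adjacency : ∀ x y → _∼_ H x y ⇔ _∼_ G (embed x) (embed y)

-- The path with k edges.
pathGraph : ∀ k → Graph (suc k)
pathGraph k = symmetrise (λ i j → toℕ j ≡ suc (toℕ i)) (λ i j → toℕ j ≟ suc (toℕ i))

-- The cycle 0, 1, …, k - 1; only meant for k ≥ 3.
cycleGraph : ∀ k → Graph k
cycleGraph k = symmetrise
  (λ i j → toℕ j ≡ suc (toℕ i) ⊎ (toℕ j ≡ 0 × suc (toℕ i) ≡ k))
  (λ i j → (toℕ j ≟ suc (toℕ i)) ⊎-dec ((toℕ j ≟ 0) ×-dec (suc (toℕ i) ≟ k)))

completeGraph : ∀ n → Graph n
completeGraph n = symmetrise (λ _ _ → ⊤) (λ _ _ → yes tt)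

Even Odd : ℕ → Set
Even k = 2 ∣ k
Odd k = ¬ Even k

record Hole {n} (G : Graph n) : Set where
  field
    len   : ℕ
    4≤len : 4 ≤ len
    cycle : cycleGraph len ⊑ G

-- Antiholes of G are the holes of its complement.
Berge : ∀ {n} → Graph n → Set
Berge G = (∀ (C : Hole G) → Even (Hole.len C))
        × (∀ (C : Hole (complement G)) → Even (Hole.len C))

-- Paths are induced; an antipath of G is a path of its complement.
record Path {n} (G : Graph n) (u v : Fin n) : Set where
  field
    len  : ℕ
    path : pathGraph len ⊑ G

  vertex : Fin (suc len) → Fin n
  vertex = _⊑_.embed path

  field
    start  : vertex zero ≡ u
    finish : vertex (fromℕ len) ≡ v

  InteriorIn : Subset n → Set
  InteriorIn X = ∀ i → i ≢ zero → i ≢ fromℕ len → vertex i ∈ X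

record Prism {n} (G : Graph n) : Set where
  open Graph G
  field
    a b        : Fin 3 → Fin n
    P          : ∀ i → Path G (a i) (b i)
    triangle-a : ∀ {i j} → i ≢ j → a i ∼ a j
    triangle-b : ∀ {i j} → i ≢ j → b i ∼ b j
    a≢b        : ∀ i j → a i ≢ b j
    disjoint   : ∀ {i j} → i ≢ j → ∀ s t →
                 Path.vertex (P i) s ≢ Path.vertex (P j) t
    only-edges : ∀ {i j} → i ≢ j → ∀ s t →
                 let x = Path.vertex (P i) s ; y = Path.vertex (P j) t in
                 x ∼ y → (x ≡ a i × y ≡ a j) ⊎ (x ≡ b i × y ≡ b j)

LongPrism : ∀ {n} → Graph n → Set
LongPrism G = Σ (Prism G) λ Q → ∃ λ i → 1 < Path.len (Prism.P Q i)

-- Delete the edge uv and join a new vertex, zero, to u and v; an old vertex x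
-- becomes suc x.
subdivideEdge : ∀ {n} (G : Graph n) (u v : Fin n) → Graph._∼_ G u v → Graph (suc n)
subdivideEdge {n} G u v _ = symmetrise R R?
  where
  open Graph G

  R : Rel (Fin (suc n)) 0ℓ
  R zero    (suc x) = x ≡ u ⊎ x ≡ v
  R (suc x) (suc y) = x ∼ y × ¬ (x ≡ u × y ≡ v) × ¬ (x ≡ v × y ≡ u)
  R _       zero    = ⊥

  R? : Decidable R
  R? zero    (suc x) = (x Fin.≟ u) ⊎-dec (x Fin.≟ v)
  R? (suc x) (suc y) = (x ∼? y) ×-dec ¬? ((x Fin.≟ u) ×-dec (y Fin.≟ v))
                                ×-dec ¬? ((x Fin.≟ v) ×-dec (y Fin.≟ u))
  R? zero    zero    = no λ ()
  R? (suc x) zero    = no λ ()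

-- Subdivisions of J up to isomorphism: the graphs obtained from J by
-- subdividing edges repeatedly, possibly never.
data SubdivisionOf {k} (J : Graph k) : ∀ {n} → Graph n → Set₁ where
  unsubdivided : SubdivisionOf J J
  subdivide    : ∀ {n} {H : Graph n} → SubdivisionOf J H →
                 ∀ u v (u∼v : Graph._∼_ H u v) →
                 SubdivisionOf J (subdivideEdge H u v u∼v)

Bipartite : ∀ {n} → Graph n → Set
Bipartite {n} G = ∃ λ (side : Fin n → Bool) → ∀ {x y} → x ∼ y → side x ≢ side y
  where open Graph G

-- Each edge is listed once, smaller end first.
edges : ∀ {n} → Graph n → List (Fin n × Fin n)
edges {n} G = filter (λ e → (proj₁ e Fin.<? proj₂ e) ×-dec (proj₁ e ∼? proj₂ e))
                     (cartesianProduct (allFin n) (allFin n))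
  where open Graph G

lineGraph : ∀ {n} (G : Graph n) → Graph (length (edges G))
lineGraph {n} G = symmetrise
  (λ i j → Share (lookup (edges G) i) (lookup (edges G) j))
  (λ i j → share? (lookup (edges G) i) (lookup (edges G) j))
  where
  Share : Rel (Fin n × Fin n) 0ℓ
  Share (u , v) (x , y) = (u ≡ x ⊎ u ≡ y) ⊎ (v ≡ x ⊎ v ≡ y)

  share? : Decidable Share
  share? (u , v) (x , y) = ((u Fin.≟ x) ⊎-dec (u Fin.≟ y)) ⊎-dec ((v Fin.≟ x) ⊎-dec (v Fin.≟ y))

-- The first four vertices are a₁, …, a₄ and the last four b₁, …, b₄, indexed
-- from 0 within each block.
doubleDiamond : Graph 8
doubleDiamond = symmetrise
  (λ x y → R (splitAt 4 x) (splitAt 4 y))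
  (λ x y → R? (splitAt 4 x) (splitAt 4 y))
  where
  2≤? : Decidable {A = Fin 4} {B = Fin 4} (λ i j → 2 ≤ toℕ i × 2 ≤ toℕ j)
  2≤? i j = (2 Data.Nat.≤? toℕ i) ×-dec (2 Data.Nat.≤? toℕ j)

  R : Rel (Fin 4 ⊎ Fin 4) 0ℓ
  R (inj₁ i) (inj₁ j) = ¬ (2 ≤ toℕ i × 2 ≤ toℕ j)
  R (inj₂ i) (inj₂ j) = ¬ (2 ≤ toℕ i × 2 ≤ toℕ j)
  R (inj₁ i) (inj₂ j) = i ≡ j
  R (inj₂ _) (inj₁ _) = ⊥

  R? : Decidable R
  R? (inj₁ i) (inj₁ j) = ¬? (2≤? i j)
  R? (inj₂ i) (inj₂ j) = ¬? (2≤? i j)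
  R? (inj₁ i) (inj₂ j) = i Fin.≟ j
  R? (inj₂ _) (inj₁ _) = no λ ()

record F₅ {n} (G : Graph n) : Set₁ where
  field
    berge          : Berge G
    no-L⟨K₄⟩       : ∀ {m} (H : Graph m) → SubdivisionOf (completeGraph 4) H → Bipartite H →
                     ¬ (lineGraph H ⊑ G) × ¬ (lineGraph H ⊑ complement G)
    no-long-prism  : ¬ LongPrism G × ¬ LongPrism (complement G)

record F₆ {n} (G : Graph n) : Set₁ where
  field
    f₅                : F₅ G
    no-double-diamond : ¬ (doubleDiamond ⊑ G)

-- Some two vertices of X are not joined by a walk in G|X.
Disconnected : ∀ {n} → Graph n → Subset n → Set
Disconnected G X = ∃₂ λ x y → x ∈ X × y ∈ X ×
                   ¬ Star (λ u v → u ∈ X × v ∈ X × u ∼ v) x y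
  where open Graph G

record SkewPartition {n} (G : Graph n) (A B : Subset n) : Set where
  field
    cover          : A ∪ B ≡ full
    disjoint       : A ∩ B ≡ empty
    A-disconnected : Disconnected G A
    B-disconnected : Disconnected (complement G) B

record Balanced {n} (G : Graph n) (A B : Subset n) : Set where
  open Graph G
  field
    no-odd-path     : ∀ {u v} → u ∈ B → v ∈ B → ¬ (u ∼ v) →
                      (P : Path G u v) → Path.InteriorIn P A → ¬ Odd (Path.len P)
    no-odd-antipath : ∀ {u v} → u ∈ A → v ∈ A → u ∼ v →
                      (P : Path (complement G) u v) → Path.InteriorIn P B → ¬ Odd (Path.len P)

{-# OPTIONS --safe #-}
-- By the Roussel–Rubio lemma (where the absence of long prisms excludes leaps), if
-- X is anticonnected and P is an odd path of length ≥ 3 whose ends but no internal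
-- vertices are X-complete, then P has length 3 and its middle vertices are joined
-- by an odd antipath through X.  Call a skew partition (A , B) loose if some b ∈ B
-- has no neighbour in some component X of A, or dually.  In that case take an
-- anticomponent Y of B without b; after minimising |X| + |Y|, moving the remaining
-- vertices to suitable sides gives a balanced skew partition, because b would
-- complete any bad path or antipath to an odd hole or antihole.
--
-- If (A , B) is not loose and u p₁ p₂ v is an odd path violating balance, there is
-- another one u q₁ q₂ v through a second component A₂ of A, and p₁, p₂ are joined by
-- an antipath p₁ x y p₂ through an anticomponent of B not containing u and v; it has
-- length 3 by the same lemma in the complement, applied to A₂.  Excluding
-- five-holes, these eight vertices induce the double diamond or L(H), with H
-- obtained from K₄ by subdividing two opposite edges.

module Submission where

open import Defs
open import Data.Bool using (Bool; true; false; not; _∧_; _∨_; _xor_; if_then_else_)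
import Data.Bool as Bool
open import Data.Bool.Properties using (not-distribˡ-xor; not-involutive; xor-identityʳ)
open import Data.Empty using (⊥; ⊥-elim)
open import Data.Fin using (Fin; zero; suc; toℕ; fromℕ)
open import Data.Fin.Patterns
open import Data.Fin.Properties using (any?; all?; toℕ-injective; toℕ≤pred[n]; toℕ-fromℕ) renaming (_≟_ to _≟ᶠ_)
open import Data.Fin.Subset using (Subset; _∈_; _∉_; _⊆_; _⊂_; _⊃_; _∪_; ⁅_⁆; ∣_∣)
open import Data.Fin.Subset.Induction using (⊃-wellFounded; ⊂-wellFounded; Acc; acc)
open import Data.Fin.Subset.Properties using (_∈?_; x∈⁅x⁆; x∈⁅y⁆⇒x≡y; x∈p∪q⁻; x∈p∪q⁺; x∈p∩q⁻; x∈p∩q⁺;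
  p⊆p∪q; q⊆p∪q; p⊂q⇒∣p∣<∣q∣; ⊆-antisym; ⊆-max; ∈⊤; ∉⊥; Empty-unique)
open import Data.Nat using (ℕ; zero; suc; _+_; _∸_; _≤_; _<_; z≤n; s≤s; _<?_; _≟_)
open import Data.Nat.Divisibility using (∣-refl; ∣m∣n⇒∣m+n; ∣m+n∣m⇒∣n; _∣0; ∣1⇒≡1)
open import Data.Nat.Induction using (<-wellFounded)
open import Data.Nat.Properties hiding (_≟_; _<?_)
open import Data.Product using (Σ; ∃; ∃₂; _×_; _,_; proj₁; proj₂)
open import Data.Sum using (_⊎_; inj₁; inj₂; [_,_]′)
import Data.Sum as Sum
open import Data.Unit using (⊤; tt)
open import Data.Vec using (Vec; []; _∷_; lookup; tabulate)
open import Data.Vec.Properties using (lookup∘tabulate; lookup⇒[]=; []=⇒lookup)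
open import Function using (_∘_; case_of_; const; id)
open import Function.Bundles using (mk⇔; Equivalence)
open import Level using (0ℓ)
open import Relation.Binary using (Rel; Decidable; Symmetric; tri<; tri≈; tri>)
open import Relation.Binary.Construct.Closure.ReflexiveTransitive as Star using (Star; ε; _◅_; _◅◅_)
open import Relation.Binary.PropositionalEquality
open import Relation.Nullary using (¬_; Dec; yes; no; does; ¬?; _×-dec_; _⊎-dec_; _→-dec_; contradiction)
open import Relation.Nullary.Decidable using (dec-true; dec-false; decidable-stable; from-yes)

-- The Roussel-Rubio lemma goes by induction on X, and what the induction carries is a parity: for
-- every proper nonempty anticonnected subset Y of X, an odd number of edges of P have both ends
-- Y-complete. Deleting two suitable vertices of X, separately and together, gives three odd counts
-- of which one would be the sum of the other two. A stable X offers no such pair; it is split into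
-- one vertex and the rest, and only there do leaps occur.
--
-- In a loose partition nothing is known of the vertices outside X, Y and b except that each is
-- anticomplete to X or complete to Y. Minimality adds that each vertex of X has a non-neighbour in
-- Y and each vertex of Y a neighbour in X, unless the set in question is a single vertex. An odd
-- path whose interior is anticomplete to X can then be rerouted through X without changing its
-- parity, since the old and the new path together form a hole. This brings the paths to be excluded
-- back to those that b can close.

-- Parity, finite subsets and bounded search

odd : ℕ → Bool
odd zero    = false
odd (suc n) = not (odd n)

odd-+ : ∀ m n → odd (m + n) ≡ odd m xor odd n
odd-+ zero    n = refl
odd-+ (suc m) n = trans (cong not (odd-+ m n)) (not-distribˡ-xor (odd m) (odd n))

≤⇒∃+ : ∀ {m n} → m ≤ n → ∃ λ d → m + d ≡ n
≤⇒∃+ m≤n = _ , m+[n∸m]≡n m≤n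

⟪_⟫ : ∀ {n} {P : Fin n → Set} → (∀ x → Dec (P x)) → Subset n
⟪ P? ⟫ = tabulate (λ x → does (P? x))

∈⟪⟫⁺ : ∀ {n} {P : Fin n → Set} (P? : ∀ x → Dec (P x)) {x} → P x → x ∈ ⟪ P? ⟫
∈⟪⟫⁺ P? {x} Px = lookup⇒[]= x _ (trans (lookup∘tabulate _ x) (dec-true (P? x) Px))

∈⟪⟫⁻ : ∀ {n} {P : Fin n → Set} (P? : ∀ x → Dec (P x)) {x} → x ∈ ⟪ P? ⟫ → P x
∈⟪⟫⁻ P? {x} x∈ with P? x | trans (sym (lookup∘tabulate (λ y → does (P? y)) x)) ([]=⇒lookup x∈)
... | yes Px | _ = Px
... | no _   | ()

∈∖? : ∀ {n} (X : Subset n) (x v : Fin n) → Dec (v ∈ X × v ≢ x)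
∈∖? X x v = (v ∈? X) ×-dec ¬? (v ≟ᶠ x)

infixl 6 _∖_
_∖_ : ∀ {n} → Subset n → Fin n → Subset n
X ∖ x = ⟪ ∈∖? X x ⟫

∈∖⁺ : ∀ {n} {X : Subset n} {x v} → v ∈ X → v ≢ x → v ∈ X ∖ x
∈∖⁺ {X = X} {x} v∈X v≢x = ∈⟪⟫⁺ (∈∖? X x) (v∈X , v≢x)

∈∖⁻ : ∀ {n} {X : Subset n} {x v} → v ∈ X ∖ x → v ∈ X × v ≢ x
∈∖⁻ {X = X} {x} = ∈⟪⟫⁻ (∈∖? X x)

∖-⊂ : ∀ {n} {X : Subset n} {x} → x ∈ X → X ∖ x ⊂ X
∖-⊂ x∈X = proj₁ ∘ ∈∖⁻ , _ , x∈X , λ x∈ → proj₂ (∈∖⁻ x∈) refl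

⊃-insert : ∀ {n} {X : Subset n} {x} → x ∉ X → (X ∪ ⁅ x ⁆) ⊃ X
⊃-insert {X = X} {x} x∉X = p⊆p∪q ⁅ x ⁆ , x , q⊆p∪q X ⁅ x ⁆ (x∈⁅x⁆ x) , x∉X

∈-insert⁻ : ∀ {n} {X : Subset n} {x v} → v ∈ X ∪ ⁅ x ⁆ → v ∈ X ⊎ v ≡ x
∈-insert⁻ {X = X} {x} v∈ = Sum.map₂ (x∈⁅y⁆⇒x≡y x) (x∈p∪q⁻ X ⁅ x ⁆ v∈)

∈-insertˡ : ∀ {n} {X : Subset n} {x v} → v ∈ X → v ∈ X ∪ ⁅ x ⁆
∈-insertˡ {x = x} = p⊆p∪q ⁅ x ⁆

∈-insertʳ : ∀ {n} {X : Subset n} {x} → x ∈ X ∪ ⁅ x ⁆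
∈-insertʳ {X = X} {x} = q⊆p∪q X ⁅ x ⁆ (x∈⁅x⁆ x)

all⊎any : ∀ {n} {P Q : Fin n → Set} → (∀ x → P x ⊎ Q x) → (∀ x → P x) ⊎ ∃ Q
all⊎any {zero}  f = inj₁ λ ()
all⊎any {suc n} f with f Fin.zero | all⊎any (f ∘ Fin.suc)
... | inj₂ q | _            = inj₂ (_ , q)
... | inj₁ _ | inj₂ (_ , q) = inj₂ (_ , q)
... | inj₁ p | inj₁ ps      = inj₁ λ { Fin.zero → p ; (Fin.suc x) → ps x }

largest : ∀ {Q : ℕ → Set} → (∀ i → Dec (Q i)) → ∀ L → ∃ (λ k → k ≤ L × Q k) →
          ∃ λ k → k ≤ L × Q k × (∀ {j} → k < j → j ≤ L → ¬ Q j)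
largest Q? zero (zero , z≤n , q) = zero , z≤n , q , λ { (s≤s _) () }
largest Q? (suc L) (k , k≤ , q) with Q? (suc L)
... | yes qL = suc L , ≤-refl , qL , λ L<j j≤L → contradiction j≤L (<⇒≱ L<j)
... | no ¬qL with largest Q? L (k , k≤L , q)
  where
  k≤L : k ≤ L
  k≤L = ≤-pred (≤∧≢⇒< k≤ λ { refl → ¬qL q })
... | m , m≤L , qm , max = m , m≤n⇒m≤1+n m≤L , qm , λ {j} m<j j≤ →
  case m≤n⇒m<n∨m≡n j≤ of λ
    { (inj₁ j<) → max m<j (≤-pred j<)
    ; (inj₂ refl) → ¬qL }

-- Graphs with two relations, and induced paths

-- A graph given by its adjacency E together with its non-adjacency N, so that
-- passing to the complement is definitionally involutive.
record Duo (n : ℕ) : Set₁ where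
  field
    E N      : Rel (Fin n) 0ℓ
    E-sym    : Symmetric E
    N-sym    : Symmetric N
    E-irrefl : ∀ {x} → ¬ E x x
    N-irrefl : ∀ {x} → ¬ N x x
    excl     : ∀ {x y} → E x y → ¬ N x y
    E?       : Decidable E
    N?       : Decidable N
    total    : ∀ {x y} → x ≢ y → ¬ E x y → ¬ ¬ N x y

  ¬E⇒N : ∀ {x y} → x ≢ y → ¬ E x y → N x y
  ¬E⇒N {x} {y} x≢y ¬e = decidable-stable (N? x y) (total x≢y ¬e)

  ¬N⇒E : ∀ {x y} → x ≢ y → ¬ N x y → E x y
  ¬N⇒E {x} {y} x≢y ¬o = decidable-stable (E? x y) λ ¬e → total x≢y ¬e ¬o

  E⇒≢ : ∀ {x y} → E x y → x ≢ y
  E⇒≢ e refl = E-irrefl e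

  N⇒≢ : ∀ {x y} → N x y → x ≢ y
  N⇒≢ o refl = N-irrefl o

-- The doubly negated form of `total` reduces swapping to a permutation of arguments, so
-- `swap (swap D)` is `D` by eta.
swap : ∀ {n} → Duo n → Duo n
swap D = record
  { E = N ; N = E ; E-sym = N-sym ; N-sym = E-sym ; E-irrefl = N-irrefl ; N-irrefl = E-irrefl
  ; excl = λ o e → excl e o ; E? = N? ; N? = E? ; total = λ x≢y ¬o ¬e → total x≢y ¬e ¬o }
  where open Duo D

infixr 5 _◂_
_◂_ : ∀ {A : Set} → A → (ℕ → A) → ℕ → A
(x ◂ p) zero    = x
(x ◂ p) (suc i) = p i

-- Position L already belongs to r; when `p L ≡ r 0` the joint is thus counted once and the lengths
-- add.
glue : ∀ {A : Set} → ℕ → (ℕ → A) → (ℕ → A) → ℕ → A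
glue zero    p r = r
glue (suc L) p r = p 0 ◂ glue L (p ∘ suc) r

glue-at : ∀ {A : Set} L (p r : ℕ → A) j →
          (j < L × glue L p r j ≡ p j) ⊎ (∃ λ t → L + t ≡ j × glue L p r j ≡ r t)
glue-at zero    p r j       = inj₂ (j , refl , refl)
glue-at (suc L) p r zero    = inj₁ (s≤s z≤n , refl)
glue-at (suc L) p r (suc j) with glue-at L (p ∘ suc) r j
... | inj₁ (j<L , eq)     = inj₁ (s≤s j<L , eq)
... | inj₂ (t , eq , eq′) = inj₂ (t , cong suc eq , eq′)

glue-end : ∀ {A : Set} L (p r : ℕ → A) t → glue L p r (L + t) ≡ r t
glue-end zero    p r t = refl
glue-end (suc L) p r t = glue-end L (p ∘ suc) r t

glue-0 : ∀ {A : Set} L (p r : ℕ → A) → p L ≡ r 0 → glue L p r 0 ≡ p 0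
glue-0 zero    p r eq = sym eq
glue-0 (suc L) p r eq = refl

module _ {n : ℕ} (D : Duo n) where
  open Duo D

  -- Indexing by ℕ makes sections, reversals and joins plain index arithmetic; values beyond L are
  -- arbitrary. Distinctness of the vertices comes from the irreflexivity of `E` and `N`.
  record IndPath (p : ℕ → Fin n) (L : ℕ) : Set where
    field
      step : ∀ {i} → i < L → E (p i) (p (suc i))
      far  : ∀ {i j} → suc i < j → j ≤ L → N (p i) (p j)

  -- Over `swap D` this says that v is anticomplete to X: it lies outside X and has no neighbour
  -- there.
  Complete : Subset n → Fin n → Set
  Complete X v = ∀ {x} → x ∈ X → E v x

  Walk : Subset n → Rel (Fin n) 0ℓ
  Walk X = Star λ u v → u ∈ X × v ∈ X × E u v

  Conn : Subset n → Set
  Conn X = ∀ {s t} → s ∈ X → t ∈ X → Walk X s t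

module _ {n : ℕ} {D : Duo n} where
  open Duo D
  open IndPath

  shift : ∀ {p L} → IndPath D p L → ∀ k {d} → k + d ≤ L → IndPath D (λ i → p (k + i)) d
  shift {p} P k k+d≤L = record
    { step = λ {i} i<d → subst (λ j → E (p (k + i)) (p j)) (sym (+-suc k i))
               (step P (≤-trans (+-monoʳ-< k i<d) k+d≤L))
    ; far  = λ {i} {j} si<j j≤d → far P
               (subst (_< k + j) (+-suc k i) (+-monoʳ-< k si<j))
               (≤-trans (+-monoʳ-≤ k j≤d) k+d≤L) }

  cons : ∀ {p L x} → IndPath D p L → E x (p 0) → (∀ {j} → 0 < j → j ≤ L → N x (p j)) →
         IndPath D (x ◂ p) (suc L)
  cons P e o = record
    { step = λ { {zero} _ → e ; {suc i} (s≤s i<L) → step P i<L }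
    ; far  = λ { {zero} {suc j} (s≤s 0<j) (s≤s j≤L) → o 0<j j≤L
               ; {suc i} {suc j} (s≤s lt) (s≤s j≤L) → far P lt j≤L } }

  rev : ∀ {p L} → IndPath D p L → IndPath D (λ i → p (L ∸ i)) L
  rev {p} {L} P = record
    { step = λ {i} i<L → E-sym (subst (λ k → E (p (L ∸ suc i)) (p k)) (sym (+-∸-assoc 1 i<L))
               (step P (∸-monoʳ-< {L} {suc i} {0} (s≤s z≤n) i<L)))
    ; far  = λ {i} {j} si<j j≤L → N-sym (far P (lemma si<j j≤L) (m∸n≤m L i)) }
    where
    lemma : ∀ {i j} → suc i < j → j ≤ L → suc (L ∸ j) < L ∸ i
    lemma {i} si<j j≤L = subst (_≤ L ∸ i) (+-∸-assoc 2 j≤L) (∸-monoʳ-≤ (2 + L) si<j)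

  adjacent⇒consecutive : ∀ {p L} → IndPath D p L → ∀ {i j} → i ≤ L → j ≤ L →
                         E (p i) (p j) → suc i ≡ j ⊎ suc j ≡ i
  adjacent⇒consecutive P {i} {j} i≤L j≤L e with <-cmp i j
  ... | tri≈ _ refl _ = contradiction e E-irrefl
  ... | tri< i<j _ _ with m≤n⇒m<n∨m≡n i<j
  ...   | inj₁ lt = contradiction (far P lt j≤L) (excl e)
  ...   | inj₂ eq = inj₁ eq
  adjacent⇒consecutive P {i} {j} i≤L j≤L e | tri> _ _ j<i with m≤n⇒m<n∨m≡n j<i
  ...   | inj₁ lt = contradiction (N-sym (far P lt i≤L)) (excl e)
  ...   | inj₂ eq = inj₂ eq

  path₁ : ∀ {u v} → E u v → IndPath D (u ◂ const v) 1
  path₁ e = record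
    { step = λ { {0} _ → e ; {suc _} (s≤s ()) }
    ; far = λ { {_} {1} (s≤s ()) ; {_} {suc (suc _)} _ (s≤s ()) } }

  path₃ : ∀ {p q r s} → E p q → E q r → E r s → N p r → N p s → N q s → IndPath D (p ◂ q ◂ r ◂ const s) 3
  path₃ pq qr rs pr ps qs = cons (cons (path₁ rs) qr λ { {1} _ _ → qs ; {suc (suc _)} _ (s≤s ()) }) pq
    λ { {1} _ _ → pr ; {2} _ _ → ps ; {suc (suc (suc _))} _ (s≤s (s≤s ())) }

  glue-path : ∀ {p r} L R → IndPath D p L → IndPath D r R → p L ≡ r 0 →
              (∀ {i j} → i < L → 0 < j → j ≤ R → N (p i) (r j)) →
              IndPath D (glue L p r) (L + R)
  glue-path zero R P Q eq o = Q
  glue-path {p} {r} (suc L) R P Q eq o = cons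
    (glue-path L R (shift P 1 ≤-refl) Q eq (λ i<L → o (s≤s i<L)))
    (subst (E (p 0)) (sym (glue-0 L (p ∘ suc) r eq)) (step P (s≤s z≤n)))
    away
    where
    away : ∀ {j} → 0 < j → j ≤ L + R → N (p 0) (glue L (p ∘ suc) r j)
    away {j} 0<j j≤ with glue-at L (p ∘ suc) r j
    ... | inj₁ (j<L , eq′) = subst (N (p 0)) (sym eq′) (far P (s≤s 0<j) (s≤s (<⇒≤ j<L)))
    ... | inj₂ (suc t , refl , eq′) = subst (N (p 0)) (sym eq′) (o (s≤s z≤n) (s≤s z≤n) (+-cancelˡ-≤ L _ _ j≤))
    ... | inj₂ (zero , refl , eq′) = subst (N (p 0)) (sym (trans eq′ (sym eq)))
      (far P (s≤s (subst (0 <_) (+-identityʳ L) 0<j)) ≤-refl)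

-- Connected sets

module _ {n : ℕ} (D : Duo n) where
  open Duo D

  Walk-mono : ∀ {X Y s t} → X ⊆ Y → Walk D X s t → Walk D Y s t
  Walk-mono X⊆Y = Star.map λ (u∈ , v∈ , e) → X⊆Y u∈ , X⊆Y v∈ , e

  Walk-sym : ∀ {X s t} → Walk D X s t → Walk D X t s
  Walk-sym = Star.reverse λ (u∈ , v∈ , e) → v∈ , u∈ , E-sym e

  Conn-rooted : ∀ {X c} → (∀ {v} → v ∈ X → Walk D X v c) → Conn D X
  Conn-rooted to-c s∈ t∈ = to-c s∈ ◅◅ Walk-sym (to-c t∈)

  Conn-singleton : ∀ x → Conn D ⁅ x ⁆
  Conn-singleton x = Conn-rooted λ v∈ → subst (λ v → Walk D ⁅ x ⁆ v x) (sym (x∈⁅y⁆⇒x≡y x v∈)) ε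

  Conn-cong : ∀ {X Y} → X ⊆ Y → Y ⊆ X → Conn D X → Conn D Y
  Conn-cong X⊆Y Y⊆X conn s∈ t∈ = Walk-mono X⊆Y (conn (Y⊆X s∈) (Y⊆X t∈))

  Conn-insert : ∀ {X u v} → Conn D X → u ∈ X → E u v → Conn D (X ∪ ⁅ v ⁆)
  Conn-insert {X} {u} {v} conn u∈ e = Conn-rooted {c = u} to-u
    where
    to-u : ∀ {w} → w ∈ X ∪ ⁅ v ⁆ → Walk D (X ∪ ⁅ v ⁆) w u
    to-u w∈ with ∈-insert⁻ w∈
    ... | inj₁ w∈X  = Walk-mono ∈-insertˡ (conn w∈X u∈)
    ... | inj₂ refl = (∈-insertʳ , ∈-insertˡ u∈ , E-sym e) ◅ ε

  crossing : ∀ {X s t} (T : Subset n) → Walk D X s t → s ∈ T → t ∉ T →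
             ∃₂ λ u v → u ∈ X × v ∈ X × u ∈ T × v ∉ T × E u v
  crossing T ε s∈ t∉ = contradiction s∈ t∉
  crossing T (_◅_ {j = w} (s∈X , w∈X , e) walk) s∈ t∉ with w ∈? T
  ... | yes w∈ = crossing T walk w∈ t∉
  ... | no w∉  = _ , _ , s∈X , w∈X , s∈ , w∉ , e

  record Component (X : Subset n) (s : Fin n) : Set where
    field
      K      : Subset n
      root   : s ∈ K
      within : K ⊆ X
      conn   : Conn D K
      closed : ∀ {u v} → u ∈ K → v ∈ X → v ∉ K → N u v

  component : ∀ X {s} → s ∈ X → Component X s
  component X {s} s∈X = grow ⁅ s ⁆ (⊃-wellFounded _) (x∈⁅x⁆ s)
    (λ v∈ → subst (_∈ X) (sym (x∈⁅y⁆⇒x≡y s v∈)) s∈X) (Conn-singleton s)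
    where
    grow : ∀ R → Acc _⊃_ R → s ∈ R → R ⊆ X → Conn D R → Component X s
    grow R (acc rs) s∈ R⊆X conn with
      any? (λ u → any? (λ v → (u ∈? R) ×-dec (v ∈? X) ×-dec ¬? (v ∈? R) ×-dec E? u v))
    ... | yes (u , v , u∈ , v∈ , v∉ , e) = grow (R ∪ ⁅ v ⁆) (rs (⊃-insert v∉)) (∈-insertˡ s∈)
            (λ w∈ → case ∈-insert⁻ w∈ of λ { (inj₁ w∈R) → R⊆X w∈R ; (inj₂ refl) → v∈ })
            (Conn-insert conn u∈ e)
    ... | no none = record
      { K = R ; root = s∈ ; within = R⊆X ; conn = conn
      ; closed = λ u∈ v∈ v∉ → ¬E⇒N (λ { refl → v∉ u∈ }) λ e → none (_ , _ , u∈ , v∈ , v∉ , e) }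

  Conn⊎Cut : ∀ X → Conn D X ⊎ ∃₂ λ s t → Σ (Component X s) λ C → t ∈ X × t ∉ Component.K C
  Conn⊎Cut X with any? (_∈? X)
  ... | no none = inj₁ λ s∈ → contradiction (_ , s∈) none
  ... | yes (s , s∈) with component X s∈
  ... | C with any? (λ t → (t ∈? X) ×-dec ¬? (t ∈? Component.K C))
  ... | yes (t , t∈ , t∉) = inj₂ (s , t , C , t∈ , t∉)
  ... | no none = inj₁ (Conn-cong within X⊆K conn)
    where
    open Component C
    X⊆K : X ⊆ K
    X⊆K {t} t∈ with t ∈? K
    ... | yes t∈K = t∈K
    ... | no t∉K  = contradiction (t , t∈ , t∉K) none

  -- R grows by one adjacent vertex at a time, and the last vertex to join is the one that can be
  -- deleted. The initial R fixes which vertices are not to be chosen.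
  non-cutvertex : ∀ {X} → Conn D X → ∀ R → Acc _⊃_ R → R ⊆ X → Conn D R → ∃ (_∈ R) →
                  ∃ (λ y → y ∈ X × y ∉ R) → ∃ λ x → x ∈ X × x ∉ R × Conn D (X ∖ x)
  non-cutvertex {X} connX R (acc rs) R⊆X connR (c , c∈) (y , y∈ , y∉)
    with crossing R (connX (R⊆X c∈) y∈) c∈ y∉
  ... | u , v , u∈X , v∈X , u∈R , v∉R , e
    with any? (λ w → (w ∈? X) ×-dec ¬? (w ∈? R) ×-dec ¬? (w ≟ᶠ v))
  ... | yes (w , w∈ , w∉ , w≢v) with non-cutvertex connX (R ∪ ⁅ v ⁆) (rs (⊃-insert v∉R))
          (λ z∈ → case ∈-insert⁻ z∈ of λ { (inj₁ z∈R) → R⊆X z∈R ; (inj₂ refl) → v∈X })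
          (Conn-insert connR u∈R e) (c , ∈-insertˡ c∈)
          (w , w∈ , λ w∈′ → [ w∉ , w≢v ]′ (∈-insert⁻ w∈′))
  ...   | x , x∈ , x∉ , conn = x , x∈ , x∉ ∘ ∈-insertˡ , conn
  non-cutvertex {X} connX R (acc rs) R⊆X connR (c , c∈) (y , y∈ , y∉)
      | u , v , u∈X , v∈X , u∈R , v∉R , e | no none = v , v∈X , v∉R , Conn-cong
    (λ z∈ → ∈∖⁺ (R⊆X z∈) λ { refl → v∉R z∈ })
    (λ {z} z∈ → let z∈X , z≢v = ∈∖⁻ z∈ in case z ∈? R of λ
      { (yes z∈R) → z∈R ; (no z∉R) → contradiction (z , z∈X , z∉R , z≢v) none })
    connR

  -- Since c is the only exit from T, a walk stopped at its first visit to c never leaves T.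
  walk-until : ∀ {X T : Subset n} {c s} → c ∈ T →
               (∀ {u v} → u ∈ X → v ∈ X → u ∈ T → u ≢ c → v ≢ c → E u v → v ∈ T) →
               s ∈ T → Walk D X s c → Walk D T s c
  walk-until c∈ keep s∈ ε = ε
  walk-until {c = c} {s} c∈ keep s∈ (_◅_ {j = w} (s∈X , w∈X , e) walk) with s ≟ᶠ c | w ≟ᶠ c
  ... | yes refl | _      = ε
  ... | no _     | yes refl = (s∈ , c∈ , e) ◅ ε
  ... | no s≢c   | no w≢c = (s∈ , w∈ , e) ◅ walk-until c∈ keep w∈ walk
    where w∈ = keep s∈X w∈X s∈ s≢c w≢c e

  -- These are the cases of the Roussel-Rubio induction, which uses them in the complement. The last
  -- argument of `removable` gives either a link of length two between x and y, hence an even one,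
  -- or the connectivity that the odd case needs.
  data Shape (X : Subset n) : Set where
    single    : ∀ {x} → x ∈ X → (∀ {y} → y ∈ X → y ≡ x) → Shape X
    clique    : ∀ {x y} → x ∈ X → y ∈ X → y ≢ x →
                (∀ {u v} → u ∈ X → v ∈ X → u ≢ v → E u v) → Shape X
    removable : ∀ {x y} → x ∈ X → y ∈ X → N x y → Conn D (X ∖ x) → Conn D (X ∖ y) →
                (∃ λ z → z ∈ X × E x z × E y z) ⊎ Conn D (X ∖ x ∖ y) → Shape X

  -- Without a cutvertex any two vertices at distance two are removable. At a cutvertex c, one
  -- vertex is taken from a component K of the rest and the other from outside K; everything that
  -- remains still reaches c.
  shape : ∀ {X} → Conn D X → ∃ (_∈ X) → Shape X
  shape {X} connX (x , x∈) with any? (λ a → any? (λ b → (a ∈? X) ×-dec (b ∈? X) ×-dec N? a b))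
  shape {X} connX (x , x∈) | no none with any? (λ y → (y ∈? X) ×-dec ¬? (y ≟ᶠ x))
  ... | yes (y , y∈ , y≢x) = clique x∈ y∈ y≢x λ u∈ v∈ u≢v → ¬N⇒E u≢v λ o → none (_ , _ , u∈ , v∈ , o)
  ... | no none′ = single x∈ λ {y} y∈ → case y ≟ᶠ x of λ
    { (yes eq) → eq ; (no y≢x) → contradiction (y , y∈ , y≢x) none′ }
  shape {X} connX _ | yes (a , b , a∈ , b∈ , ab)
    with all⊎any {P = λ c → Conn D (X ∖ c)} (λ c → Conn⊎Cut (X ∖ c))
  ... | inj₁ no-cut = far-pair (crossing T (connX a∈ b∈) (∈⟪⟫⁺ T? (inj₁ refl))
                       λ b∈T → [ (λ { refl → N-irrefl ab }) , (λ e → excl e ab) ]′ (∈⟪⟫⁻ T? b∈T))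
    where
    T? : ∀ v → Dec (v ≡ a ⊎ E a v)
    T? v = (v ≟ᶠ a) ⊎-dec E? a v
    T = ⟪ T? ⟫
    far-pair : (∃₂ λ u v → u ∈ X × v ∈ X × u ∈ T × v ∉ T × E u v) → Shape X
    far-pair (u , v , u∈ , v∈ , u∈T , v∉T , e) with ∈⟪⟫⁻ T? u∈T
    ... | inj₁ refl = contradiction (∈⟪⟫⁺ T? (inj₂ e)) v∉T
    ... | inj₂ au = removable a∈ v∈
      (¬E⇒N (λ { refl → v∉T (∈⟪⟫⁺ T? (inj₁ refl)) }) (λ av → v∉T (∈⟪⟫⁺ T? (inj₂ av))))
      (no-cut a) (no-cut v) (inj₁ (u , u∈ , au , E-sym e))
  ... | inj₂ (c , s , t , C , t∈ , t∉) = split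
    where
    open Component C
    K∪c = K ∪ ⁅ c ⁆
    rest? : ∀ v → Dec (v ∈ X × v ∉ K)
    rest? v = (v ∈? X) ×-dec ¬? (v ∈? K)
    rest = ⟪ rest? ⟫
    c∉K : c ∉ K
    c∉K c∈ = proj₂ (∈∖⁻ (within c∈)) refl
    K⊆X : K ⊆ X
    K⊆X = proj₁ ∘ ∈∖⁻ ∘ within
    c∈X : c ∈ X
    c∈X with c ∈? X
    ... | yes c∈ = c∈
    ... | no c∉ with crossing K (connX (K⊆X root) (proj₁ (∈∖⁻ t∈))) root t∉
    ...   | u , v , u∈ , v∈ , u∈K , v∉K , e =
      contradiction (closed u∈K (∈∖⁺ v∈ λ { refl → c∉ v∈ }) v∉K) (excl e)
    c∈rest : c ∈ rest
    c∈rest = ∈⟪⟫⁺ rest? (c∈X , c∉K)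
    conn₁ : Conn D K∪c
    conn₁ = Conn-rooted λ v∈ → walk-until ∈-insertʳ
      (λ {u} {v} _ v∈X u∈ u≢c v≢c e → case ∈-insert⁻ u∈ of λ
        { (inj₂ u≡c) → contradiction u≡c u≢c
        ; (inj₁ u∈K) → case v ∈? K of λ
          { (yes v∈K) → ∈-insertˡ v∈K
          ; (no v∉K) → contradiction (closed u∈K (∈∖⁺ v∈X v≢c) v∉K) (excl e) } })
      v∈ (connX (case ∈-insert⁻ v∈ of λ { (inj₁ v∈K) → K⊆X v∈K ; (inj₂ refl) → c∈X }) c∈X)
    conn₂ : Conn D rest
    conn₂ = Conn-rooted λ v∈ → walk-until c∈rest
      (λ {u} {v} u∈X v∈X u∈ u≢c v≢c e → ∈⟪⟫⁺ rest? (v∈X , λ v∈K →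
        excl (E-sym e) (closed v∈K (∈∖⁺ u∈X u≢c) (proj₂ (∈⟪⟫⁻ rest? u∈)))))
      v∈ (connX (proj₁ (∈⟪⟫⁻ rest? v∈)) c∈X)
    split : Shape X
    -- Growing from c alone guarantees that neither deleted vertex is c itself.
    split with non-cutvertex conn₁ ⁅ c ⁆ (⊃-wellFounded _)
                 (λ v∈ → subst (_∈ K∪c) (sym (x∈⁅y⁆⇒x≡y c v∈)) ∈-insertʳ)
                 (Conn-singleton c) (c , x∈⁅x⁆ c)
                 (s , ∈-insertˡ root , λ s∈ → c∉K (subst (_∈ K) (x∈⁅y⁆⇒x≡y c s∈) root))
             | non-cutvertex conn₂ ⁅ c ⁆ (⊃-wellFounded _)
                 (λ v∈ → subst (_∈ rest) (sym (x∈⁅y⁆⇒x≡y c v∈)) c∈rest)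
                 (Conn-singleton c) (c , x∈⁅x⁆ c)
                 (t , ∈⟪⟫⁺ rest? (proj₁ (∈∖⁻ t∈) , t∉) , λ t∈′ → proj₂ (∈∖⁻ t∈) (x∈⁅y⁆⇒x≡y c t∈′))
    ... | x , x∈ , x∉c , connx | y , y∈ , y∉c , conny =
      removable (K⊆X x∈K) y∈X (closed x∈K (∈∖⁺ y∈X y≢c) y∉K)
        (rooted (proj₁ ∘ ∈∖⁻)
          (λ v∈ v∈K → Walk-mono (proj₁ ∘ ∈∖⁻ ∘ K∪c∖x⊆) (walk₁ v∈K (proj₂ (∈∖⁻ v∈))))
          (λ _ v∈rest → Walk-mono rest⊆ (conn₂ v∈rest c∈rest)))
        (rooted (proj₁ ∘ ∈∖⁻)
          (λ _ v∈K → Walk-mono K∪c⊆ (conn₁ (∈-insertˡ v∈K) ∈-insertʳ))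
          (λ v∈ v∈rest → Walk-mono (λ w∈ → let w∈r , w≢y = ∈∖⁻ w∈ in
             ∈∖⁺ (proj₁ (∈⟪⟫⁻ rest? w∈r)) w≢y) (walk₂ v∈rest (proj₂ (∈∖⁻ v∈)))))
        (inj₂ (rooted (proj₁ ∘ ∈∖⁻ ∘ proj₁ ∘ ∈∖⁻)
          (λ v∈ v∈K → Walk-mono K∪c∖x⊆ (walk₁ v∈K (proj₂ (∈∖⁻ (proj₁ (∈∖⁻ v∈))))))
          (λ v∈ v∈rest → Walk-mono rest∖y⊆ (walk₂ v∈rest (proj₂ (∈∖⁻ v∈))))))
      where
      x≢c : x ≢ c
      x≢c refl = x∉c (x∈⁅x⁆ c)
      y≢c : y ≢ c
      y≢c refl = y∉c (x∈⁅x⁆ c)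
      x∈K : x ∈ K
      x∈K = case ∈-insert⁻ x∈ of λ { (inj₁ p) → p ; (inj₂ q) → contradiction q x≢c }
      y∈X = proj₁ (∈⟪⟫⁻ rest? y∈)
      y∉K = proj₂ (∈⟪⟫⁻ rest? y∈)
      walk₁ : ∀ {v} → v ∈ K → v ≢ x → Walk D (K∪c ∖ x) v c
      walk₁ v∈K v≢x = connx (∈∖⁺ (∈-insertˡ v∈K) v≢x) (∈∖⁺ ∈-insertʳ (x≢c ∘ sym))
      walk₂ : ∀ {v} → v ∈ rest → v ≢ y → Walk D (rest ∖ y) v c
      walk₂ v∈ v≢y = conny (∈∖⁺ v∈ v≢y) (∈∖⁺ c∈rest (y≢c ∘ sym))
      K∪c⊆ : K∪c ⊆ X ∖ y
      K∪c⊆ v∈ = case ∈-insert⁻ v∈ of λ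
        { (inj₁ v∈K) → ∈∖⁺ (K⊆X v∈K) λ { refl → y∉K v∈K } ; (inj₂ refl) → ∈∖⁺ c∈X (y≢c ∘ sym) }
      K∪c∖x⊆ : K∪c ∖ x ⊆ X ∖ x ∖ y
      K∪c∖x⊆ v∈ = let v∈′ , v≢x = ∈∖⁻ v∈ ; v∈X , v≢y = ∈∖⁻ (K∪c⊆ v∈′) in ∈∖⁺ (∈∖⁺ v∈X v≢x) v≢y
      rest⊆ : rest ⊆ X ∖ x
      rest⊆ v∈ = let v∈X , v∉K = ∈⟪⟫⁻ rest? v∈ in ∈∖⁺ v∈X λ { refl → v∉K x∈K }
      rest∖y⊆ : rest ∖ y ⊆ X ∖ x ∖ y
      rest∖y⊆ v∈ = let v∈′ , v≢y = ∈∖⁻ v∈ in ∈∖⁺ (rest⊆ v∈′) v≢y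
      rooted : ∀ {Z} → Z ⊆ X → (∀ {v} → v ∈ Z → v ∈ K → Walk D Z v c) →
               (∀ {v} → v ∈ Z → v ∈ rest → Walk D Z v c) → Conn D Z
      rooted Z⊆X inK inRest = Conn-rooted λ {v} v∈ → case v ∈? K of λ
        { (yes v∈K) → inK v∈ v∈K ; (no v∉K) → inRest v∈ (∈⟪⟫⁺ rest? (Z⊆X v∈ , v∉K)) }

-- Links through connected sets, and odd holes

module _ {n : ℕ} (D : Duo n) where
  open Duo D

  record Link (S : Subset n) (u v : Fin n) : Set where
    field
      {p}      : ℕ → Fin n
      {L}      : ℕ
      path     : IndPath D p L
      2≤L      : 2 ≤ L
      start    : p 0 ≡ u
      finish   : p L ≡ v
      interior : ∀ {i} → 0 < i → i < L → p i ∈ S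

  -- The vertex v closes p to a hole with L + 2 vertices, so its parity is that of L.
  OddHoleFree : Set
  OddHoleFree = ∀ {p L v} → IndPath D p L → 2 ≤ L → E v (p 0) → E v (p L) →
                (∀ {i} → 0 < i → i < L → N v (p i)) → odd L ≡ true → ⊥

  -- This is the leap of Roussel and Rubio on a path of length `suc K`: x and y both see the two
  -- ends, and inside the path x sees only the first vertex and y only the last.
  NoLeap : Set
  NoLeap = ∀ {p K x y} → IndPath D p (suc K) → 4 ≤ K → N x y →
           E x (p 0) → E x (p 1) → E x (p (suc K)) → (∀ {i} → 1 < i → i ≤ K → N x (p i)) →
           E y (p 0) → E y (p K) → E y (p (suc K)) → (∀ {i} → 0 < i → i < K → N y (p i)) → ⊥

module _ {n : ℕ} {D : Duo n} where
  open Duo D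
  open IndPath

  -- Entering the path at the last vertex equal or adjacent to x is the shortcut that makes a walk
  -- induced; equality occurs when the walk returns to x.
  latest-neighbour : ∀ (p : ℕ → Fin n) L x → ∃ (λ k → k ≤ L × (x ≡ p k ⊎ E x (p k))) →
    ∃ λ k → k ≤ L × (x ≡ p k ⊎ (E x (p k) × (∀ {j} → k < j → j ≤ L → N x (p j))))
  latest-neighbour p L x found with largest (λ k → (x ≟ᶠ p k) ⊎-dec E? x (p k)) L found
  ... | k , k≤L , inj₁ eq , later = k , k≤L , inj₁ eq
  ... | k , k≤L , inj₂ e  , later =
    k , k≤L , inj₂ (e , λ k<j j≤L → ¬E⇒N (later k<j j≤L ∘ inj₁) (later k<j j≤L ∘ inj₂))

  prepend : ∀ {p k d x} → IndPath D p (k + d) → E x (p k) →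
            (∀ {j} → k < j → j ≤ k + d → N x (p j)) → IndPath D (x ◂ λ i → p (k + i)) (suc d)
  prepend {p} {k} {d} {x} P e later = cons (shift P k ≤-refl)
    (subst (E x ∘ p) (sym (+-identityʳ k)) e)
    λ {j} 0<j j≤d → later (subst (_< k + j) (+-identityʳ k) (+-monoʳ-< k 0<j)) (+-monoʳ-≤ k j≤d)

  private
    record Tail (S : Subset n) (s v : Fin n) : Set where
      field
        {p}      : ℕ → Fin n
        {L}      : ℕ
        path     : IndPath D p L
        start    : p 0 ≡ s
        finish   : p L ≡ v
        interior : ∀ {i} → i < L → p i ∈ S

    tail : ∀ {S s t v} → v ∉ S → s ∈ S → Walk D S s t → E t v → Tail S s v
    tail {S} {s} {v = v} v∉ s∈ ε e = record
      { path = path₁ e ; start = refl ; finish = refl ; interior = λ { {zero} _ → s∈ ; {suc i} (s≤s ()) } }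
    tail {S} {s} {v = v} v∉ s∈ ((_ , w∈ , e) ◅ walk) e′ with tail v∉ w∈ walk e′
    ... | record { p = p ; L = L ; path = P ; start = refl ; finish = refl ; interior = int }
      with latest-neighbour p L s (0 , z≤n , inj₂ e)
    ... | k , k≤L , step′ with ≤⇒∃+ k≤L
    tail {S} {s} {v = v} v∉ s∈ ((_ , w∈ , e) ◅ walk) e′
        | record { p = p ; path = P ; start = refl ; finish = refl ; interior = int }
        | k , k≤L , inj₁ refl | d , refl = record
          { path = shift P k ≤-refl ; start = cong p (+-identityʳ k) ; finish = refl
          ; interior = λ i<d → int (+-monoʳ-< k i<d) }
    tail {S} {s} {v = v} v∉ s∈ ((_ , w∈ , e) ◅ walk) e′
        | record { p = p ; path = P ; start = refl ; finish = refl ; interior = int }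
        | k , k≤L , inj₂ (e″ , later) | d , refl = record
          { path = prepend P e″ later ; start = refl ; finish = refl
          ; interior = λ { {zero} _ → s∈ ; {suc i} (s≤s i<d) → int (+-monoʳ-< k i<d) } }

  connect : ∀ {S u v} → Conn D S → u ∉ S → v ∉ S → N u v →
            ∃ (λ s → s ∈ S × E u s) → ∃ (λ t → t ∈ S × E v t) → Link D S u v
  connect {S} {u} {v} conn u∉ v∉ uv (s , s∈ , us) (t , t∈ , vt)
    with tail v∉ s∈ (conn s∈ t∈) (E-sym vt)
  ... | record { p = p ; L = L ; path = P ; start = refl ; finish = refl ; interior = int }
    with latest-neighbour p L u (0 , z≤n , inj₂ us)
  ... | k , k≤L , step′ with ≤⇒∃+ k≤L
  connect uu u∉ v∉ uv _ _
      | record { p = p ; L = L ; path = P ; start = refl ; finish = refl ; interior = int }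
      | k , k≤L , inj₁ refl | d , eq with m≤n⇒m<n∨m≡n k≤L
  ... | inj₁ k<L  = contradiction (int k<L) u∉
  ... | inj₂ refl = contradiction uv N-irrefl
  connect uu u∉ v∉ uv _ _
      | record { p = p ; path = P ; start = refl ; finish = refl ; interior = int }
      | k , k≤L , inj₂ (e , later) | zero , refl =
        contradiction uv (excl (subst (E _ ∘ p) (sym (+-identityʳ k)) e))
  connect uu u∉ v∉ uv _ _
      | record { p = p ; path = P ; start = refl ; finish = refl ; interior = int }
      | k , k≤L , inj₂ (e , later) | suc d , refl = record
        { path = prepend P e later ; 2≤L = s≤s (s≤s z≤n) ; start = refl ; finish = refl
        ; interior = λ { {suc i} _ (s≤s i<d) → int (+-monoʳ-< k i<d) } }

  module _ (hole : OddHoleFree D) where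

    -- Closing a link of length L by one, two or three further vertices gives holes with L + 2, L +
    -- 3 or L + 4 vertices, so the forbidden parity of L alternates. Over `swap D` these are the
    -- antiholes closing an antipath.
    close₁ : ∀ {S a b w} (Q : Link D S a b) → E w a → E w b → (∀ {s} → s ∈ S → N w s) →
             odd (Link.L Q) ≡ true → ⊥
    close₁ record { path = P ; 2≤L = 2≤L ; start = refl ; finish = refl ; interior = int } wa wb ws =
      hole P 2≤L wa wb λ 0<i i<L → ws (int 0<i i<L)

    close₂ : ∀ {S a b x y} (Q : Link D S a b) → E x a → N x b → (∀ {s} → s ∈ S → N x s) →
             E y x → E y b → N y a → (∀ {s} → s ∈ S → N y s) → odd (Link.L Q) ≡ false → ⊥
    close₂ record { p = p ; L = L ; path = P ; 2≤L = 2≤L ; start = refl ; finish = refl ; interior = int }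
           xa xb xs yx yb ya ys even = hole
      (cons P xa λ 0<j j≤L → case m≤n⇒m<n∨m≡n j≤L of λ
        { (inj₁ j<L) → xs (int 0<j j<L) ; (inj₂ refl) → xb })
      (m≤n⇒m≤1+n 2≤L) yx yb
      (λ { {suc zero} _ _ → ya ; {suc (suc i)} _ (s≤s i<L) → ys (int (s≤s z≤n) i<L) })
      (cong not even)

    close₃ : ∀ {S a b x y w} (Q : Link D S a b) →
             E x a → N x b → (∀ {s} → s ∈ S → N x s) →
             E w x → N w a → N w b → (∀ {s} → s ∈ S → N w s) →
             E y w → E y b → N y x → N y a → (∀ {s} → s ∈ S → N y s) → odd (Link.L Q) ≡ true → ⊥
    close₃ record { p = p ; L = L ; path = P ; 2≤L = 2≤L ; start = refl ; finish = refl ; interior = int }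
           xa xb xs wx wa wb ws yw yb yx ya ys o = hole
      (cons (cons P xa λ 0<j j≤L → case m≤n⇒m<n∨m≡n j≤L of λ
              { (inj₁ j<L) → xs (int 0<j j<L) ; (inj₂ refl) → xb })
            wx λ { {suc zero} _ _ → wa
                 ; {suc (suc j)} _ (s≤s j≤L) → case m≤n⇒m<n∨m≡n j≤L of λ
                   { (inj₁ j<L) → ws (int (s≤s z≤n) j<L) ; (inj₂ refl) → wb } })
      (m≤n⇒m≤1+n (m≤n⇒m≤1+n 2≤L)) yw yb
      (λ { {suc zero} _ _ → yx ; {suc (suc zero)} _ _ → ya
         ; {suc (suc (suc i))} _ (s≤s (s≤s i<L)) → ys (int (s≤s z≤n) i<L) })
      (cong (not ∘ not) o)

    no-five-hole : ∀ {p q r s w} → E p q → E q r → E r s → E s w → E w p →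
                   N p r → N p s → N q s → N w q → N w r → ⊥
    no-five-hole pq qr rs sw wp pr ps qs wq wr = hole (path₃ pq qr rs pr ps qs) (s≤s (s≤s z≤n)) wp (E-sym sw)
      (λ { {1} _ _ → wq ; {2} _ _ → wr ; {suc (suc (suc _))} _ (s≤s (s≤s (s≤s ()))) }) refl

    -- The two paths bound a hole with L + M vertices. To fit `OddHoleFree`, `q 1` is taken as the
    -- closing vertex and P is continued along Q backwards to `q 2`.
    theta : ∀ {p q L M} → IndPath D p L → IndPath D q M → 2 ≤ L → 2 ≤ M →
            p 0 ≡ q 0 → p L ≡ q M →
            (∀ {i j} → 0 < i → i < L → 0 < j → j < M → N (p i) (q j)) → odd L ≡ odd M
    theta {M = suc zero} P Q 2≤L (s≤s ()) _ _ _
    theta {p} {q} {L} {M@(suc (suc R))} P Q 2≤L 2≤M eq₀ eq₁ cross =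
      xor-false (odd L) (odd R) λ o → hole
        (glue-path L R P (shift (rev Q) 0 (m≤n+m R 2)) eq₁ apart)
        (≤-trans 2≤L (m≤m+n L R))
        (subst (E (q 1)) (sym (trans (glue-0 L p r eq₁) eq₀)) (E-sym (step Q (s≤s z≤n))))
        (subst (E (q 1)) (sym (trans (glue-end L p r R) (cong q (m+n∸n≡m 2 R)))) (step Q (s≤s (s≤s z≤n))))
        away (trans (odd-+ L R) o)
      where
      r : ℕ → Fin n
      r j = q (M ∸ j)
      xor-false : ∀ a b → (a xor b ≡ true → ⊥) → a ≡ not (not b)
      xor-false false false _ = refl
      xor-false true  true  _ = refl
      xor-false false true  f = ⊥-elim (f refl)
      xor-false true  false f = ⊥-elim (f refl)
      inner : ∀ {j} → j ≤ R → 2 ≤ M ∸ j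
      inner {j} j≤R = subst (2 ≤_) (sym (+-∸-assoc 2 j≤R)) (s≤s (s≤s z≤n))
      apart : ∀ {i j} → i < L → 0 < j → j ≤ R → N (p i) (r j)
      apart {zero} {j} _ _ j≤R = subst (λ v → N v (r j)) (sym eq₀) (far Q (inner j≤R) (m∸n≤m M j))
      apart {suc i} {j} i<L 0<j j≤R = cross (s≤s z≤n) i<L (≤-trans (s≤s z≤n) (inner j≤R))
        (∸-monoʳ-< {M} {j} {0} 0<j (≤-trans j≤R (m≤n+m R 2)))
      away : ∀ {j} → 0 < j → j < L + R → N (q 1) (glue L p r j)
      away {j} 0<j j< with glue-at L p r j
      ... | inj₁ (j<L , eq) = subst (N (q 1)) (sym eq) (N-sym (cross 0<j j<L (s≤s z≤n) 2≤M))
      ... | inj₂ (t , refl , eq) = subst (N (q 1)) (sym eq) (far Q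
              (subst (2 <_) (sym (+-∸-assoc 2 (<⇒≤ t<R))) (s≤s (s≤s (m<n⇒0<n∸m t<R)))) (m∸n≤m M t))
        where
        t<R : t < R
        t<R = +-cancelˡ-< L _ _ j<

-- Parity along a path

-- This is the number, modulo two, of edges among the first k whose two ends are marked.
edge-parity : (ℕ → Bool) → ℕ → Bool
edge-parity m zero    = false
edge-parity m (suc k) = edge-parity m k xor (m k ∧ m (suc k))

Gaps : (ℕ → Bool) → ℕ → Set
Gaps m L = ∀ {k d} → k + d ≤ L → m k ≡ true → m (k + d) ≡ true →
           (∀ {i} → 0 < i → i < d → m (k + i) ≡ false) → odd d ≡ true → d ≡ 1

-- The marks cut the path into gaps of total length L. Even gaps do not affect the parity, and each
-- odd gap is a single marked edge.
edge-parity≡odd : ∀ {m L} → Gaps m L → m 0 ≡ true → m L ≡ true → edge-parity m L ≡ odd L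
edge-parity≡odd {m} {L} gaps m0 mL with last-mark L ≤-refl
  where
  -- Here j is the last mark up to k. The parity agrees with `odd` at j and stays constant until the
  -- next mark.
  last-mark : ∀ k → k ≤ L → ∃₂ λ j d → j + d ≡ k × m j ≡ true ×
              (∀ {i} → 0 < i → i ≤ d → m (j + i) ≡ false) ×
              edge-parity m j ≡ odd j × edge-parity m k ≡ edge-parity m j
  last-mark zero _ = 0 , 0 , refl , m0 , (λ { (s≤s _) () }) , refl , refl
  last-mark (suc k) k<L with last-mark k (<⇒≤ k<L) | m (suc k) in eq
  ... | j , d , refl , mj , clear , ej , ek | false =
    j , suc d , +-suc j d , mj , clear′ , ej ,
    trans (cong (_xor (m k ∧ false)) ek) (xor∧false (edge-parity m j) (m k))
    where
    xor∧false : ∀ a b → a xor (b ∧ false) ≡ a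
    xor∧false false false = refl
    xor∧false false true  = refl
    xor∧false true  false = refl
    xor∧false true  true  = refl
    clear′ : ∀ {i} → 0 < i → i ≤ suc d → m (j + i) ≡ false
    clear′ 0<i i≤ with m≤n⇒m<n∨m≡n i≤
    ... | inj₁ (s≤s i≤d) = clear 0<i i≤d
    ... | inj₂ refl = trans (cong m (+-suc j d)) eq
  ... | j , d , refl , mj , clear , ej , ek | true =
    suc k , 0 , cong suc (+-identityʳ k) , eq , (λ { (s≤s _) () }) , parity d refl ,
    cong (λ b → edge-parity m k xor (m k ∧ b)) (sym eq)
    where
    parity : ∀ d′ → d′ ≡ d → edge-parity m (suc k) ≡ odd (suc k)
    parity zero refl rewrite +-identityʳ j | eq | mj | ej = xor-true (odd j)
      where
      xor-true : ∀ a → a xor true ≡ not a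
      xor-true false = refl
      xor-true true  = refl
    parity (suc d′) refl rewrite clear {d} (s≤s z≤n) ≤-refl | ek | ej
      with odd (suc d) in odd-d
    ... | true = contradiction
      (gaps (subst (_≤ L) (sym (+-suc j d)) k<L) mj (trans (cong m (+-suc j d)) eq)
        (λ { 0<i (s≤s i≤d) → clear 0<i i≤d }) odd-d) λ ()
    ... | false = trans (cong (odd j xor_) (sym odd-d))
                  (trans (sym (odd-+ j (suc d))) (cong odd (+-suc j d)))
... | j , zero , eq , mj , clear , ej , ek rewrite trans (sym (+-identityʳ j)) eq = ej
... | j , suc d , refl , mj , clear , ej , ek with trans (sym mL) (clear (s≤s z≤n) ≤-refl)
...   | ()

edge-parity-cong : ∀ {m m′} L → (∀ {k} → k ≤ L → m k ≡ m′ k) → edge-parity m L ≡ edge-parity m′ L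
edge-parity-cong zero    eq = refl
edge-parity-cong (suc L) eq = cong₂ _xor_ (edge-parity-cong L (eq ∘ m≤n⇒m≤1+n))
                                          (cong₂ _∧_ (eq (n≤1+n L)) (eq ≤-refl))

edge-exists : ∀ m L → edge-parity m L ≡ true → ∃ λ k → k < L × m k ≡ true × m (suc k) ≡ true
edge-exists m (suc L) o with m L in eq | m (suc L) in eq′
... | true  | true  = L , ≤-refl , eq , eq′
... | true  | false with edge-exists m L (trans (sym (xor-identityʳ _)) o)
... | k , k<L , mk = k , m≤n⇒m≤1+n k<L , mk
edge-exists m (suc L) o | false | _ with edge-exists m L (trans (sym (xor-identityʳ _)) o)
... | k , k<L , mk = k , m≤n⇒m≤1+n k<L , mk

record NoMixedEdge (m m′ : ℕ → Bool) (k : ℕ) : Set where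
  field
    common : m k ≡ true → m′ k ≡ true → m (suc k) ≡ true → m′ (suc k) ≡ true → ⊥
    up     : m k ≡ true → m′ k ≡ false → m (suc k) ≡ false → m′ (suc k) ≡ true → ⊥
    down   : m k ≡ false → m′ k ≡ true → m (suc k) ≡ true → m′ (suc k) ≡ false → ⊥

-- Edge by edge, the count for the union differs from the sum of the two counts only if the edge is
-- counted twice or has one end marked by m alone and the other by m′ alone.
edge-parity-∨ : ∀ {m m′} L → (∀ {k} → k < L → NoMixedEdge m m′ k) →
                edge-parity (λ k → m k ∨ m′ k) L ≡ edge-parity m L xor edge-parity m′ L
edge-parity-∨ zero ok = refl
edge-parity-∨ {m} {m′} (suc L) ok
  rewrite edge-parity-∨ {m} {m′} L (ok ∘ m≤n⇒m≤1+n) =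
  trans (cong ((edge-parity m L xor edge-parity m′ L) xor_)
          (edge (m L) (m′ L) (m (suc L)) (m′ (suc L)) common up down))
        (interchange (edge-parity m L) (edge-parity m′ L) _ _)
  where
  open NoMixedEdge (ok {L} ≤-refl)
  edge : ∀ a b c d → (a ≡ true → b ≡ true → c ≡ true → d ≡ true → ⊥) →
         (a ≡ true → b ≡ false → c ≡ false → d ≡ true → ⊥) →
         (a ≡ false → b ≡ true → c ≡ true → d ≡ false → ⊥) →
         (a ∨ b) ∧ (c ∨ d) ≡ (a ∧ c) xor (b ∧ d)
  edge true  true  true  true  f g h = ⊥-elim (f refl refl refl refl)
  edge true  true  true  false f g h = refl
  edge true  true  false true  f g h = refl
  edge true  true  false false f g h = refl
  edge true  false true  true  f g h = refl
  edge true  false true  false f g h = refl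
  edge true  false false true  f g h = ⊥-elim (g refl refl refl refl)
  edge true  false false false f g h = refl
  edge false true  true  true  f g h = refl
  edge false true  true  false f g h = ⊥-elim (h refl refl refl refl)
  edge false true  false true  f g h = refl
  edge false true  false false f g h = refl
  edge false false c     d     f g h = refl
  interchange : ∀ a b c d → (a xor b) xor (c xor d) ≡ (a xor c) xor (b xor d)
  interchange false false c d = refl
  interchange false true  false d = refl
  interchange false true  true false = refl
  interchange false true  true true = refl
  interchange true  false false d = refl
  interchange true  false true false = refl
  interchange true  false true true = refl
  interchange true  true  false false = refl
  interchange true  true  false true = refl
  interchange true  true  true false = refl
  interchange true  true  true true = refl

-- The Roussel–Rubio lemma

module _ {n : ℕ} (D : Duo n) where
  open Duo D

  -- The bound 5 leaves out length 3, where an odd antipath through X between the two middle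
  -- vertices is a genuine alternative.
  HasInteriorComplete : Subset n → Set
  HasInteriorComplete X = ∀ {p L} → IndPath D p L → 5 ≤ L → odd L ≡ true →
    (∀ {i} → i ≤ L → p i ∉ X) → Complete D X (p 0) → Complete D X (p L) →
    ∃ λ i → 0 < i × i < L × Complete D X (p i)

module _ {n : ℕ} {D : Duo n} where
  open Duo D
  open IndPath

  Complete⇒∉ : ∀ {X v} → Complete D X v → v ∉ X
  Complete⇒∉ c v∈ = E-irrefl (c v∈)

  non-neighbour : ∀ {X : Subset n} {v} → v ∉ X → ¬ Complete D X v → ∃ λ x → x ∈ X × N v x
  non-neighbour {X} {v} v∉X ¬c with any? (λ x → (x ∈? X) ×-dec N? v x)
  ... | yes (x , x∈ , o) = x , x∈ , o
  ... | no none = contradiction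
    (λ {x} x∈ → ¬N⇒E (λ { refl → v∉X x∈ }) λ o → none (x , x∈ , o)) ¬c

  complete? : ∀ (X : Subset n) v → Dec (Complete D X v)
  complete? X v with any? (λ x → (x ∈? X) ×-dec ¬? (E? v x))
  ... | yes (x , x∈ , ¬e) = no λ c → ¬e (c x∈)
  ... | no none = yes λ {x} x∈ → case E? v x of λ
    { (yes e) → e ; (no ¬e) → contradiction (x , x∈ , ¬e) none }

  Complete-insert : ∀ {X : Subset n} {x v} → Complete D (X ∖ x) v → E v x → Complete D X v
  Complete-insert {X} {x} c e {y} y∈ with y ≟ᶠ x
  ... | yes refl = e
  ... | no y≢x   = c (∈∖⁺ y∈ y≢x)

  mark : Subset n → (ℕ → Fin n) → ℕ → Bool
  mark X p k = does (complete? X (p k))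

  mark⁺ : ∀ X p {k} → Complete D X (p k) → mark X p k ≡ true
  mark⁺ X p {k} = dec-true (complete? X (p k))

  mark⁻ : ∀ X p {k} → mark X p k ≡ true → Complete D X (p k)
  mark⁻ X p {k} eq with complete? X (p k)
  ... | yes c = c

  unmarked⁺ : ∀ X p {k} → ¬ Complete D X (p k) → mark X p k ≡ false
  unmarked⁺ X p {k} = dec-false (complete? X (p k))

  unmarked⁻ : ∀ X p {k} → mark X p k ≡ false → ¬ Complete D X (p k)
  unmarked⁻ X p {k} eq with complete? X (p k)
  ... | no ¬c = ¬c

  -- An end of P away from a section is complete to X yet adjacent to nothing in the section; it
  -- serves as the extra vertex that closes holes and antiholes.
  far-end : ∀ {p L a b} → IndPath D p L → 2 ≤ a ⊎ suc b < L → b ≤ L →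
            ∃ λ w → (w ≡ p 0 ⊎ w ≡ p L) × (∀ {i} → a ≤ i → i ≤ b → N w (p i))
  far-end {p} P (inj₁ 2≤a) b≤L = p 0 , inj₁ refl , λ a≤i i≤b → far P (≤-trans 2≤a a≤i) (≤-trans i≤b b≤L)
  far-end {p} {L} P (inj₂ b<) b≤L = p L , inj₂ refl , λ a≤i i≤b → N-sym (far P (≤-trans (s≤s (s≤s i≤b)) b<) ≤-refl)

  near-start : ∀ {L} k → 5 ≤ L → 2 ≤ k ⊎ suc (suc k) < L
  near-start zero          5≤L = inj₂ (≤-trans (s≤s (s≤s (s≤s z≤n))) 5≤L)
  near-start (suc zero)    5≤L = inj₂ (≤-trans (s≤s (s≤s (s≤s (s≤s z≤n)))) 5≤L)
  near-start (suc (suc k)) 5≤L = inj₁ (s≤s (s≤s z≤n))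

  Complete-end : ∀ {X : Subset n} {p : ℕ → Fin n} {L w} → Complete D X (p 0) → Complete D X (p L) →
                 w ≡ p 0 ⊎ w ≡ p L → Complete D X w
  Complete-end c₀ _  (inj₁ refl) = c₀
  Complete-end _  cL (inj₂ refl) = cL

  module _ (antihole : OddHoleFree (swap D)) where

    -- Longer odd gaps would have a complete vertex inside, so length 3 is the real case. The two
    -- inner vertices are joined by an antipath through X: if even, it closes with the ends of the
    -- gap to an odd antihole; if odd, it closes with an end of P away from them.
    gaps : ∀ {X p L} → HasInteriorComplete D X → Conn (swap D) X →
           IndPath D p L → 5 ≤ L → (∀ {i} → i ≤ L → p i ∉ X) → Complete D X (p 0) → Complete D X (p L) →
           Gaps (mark X p) L
    gaps _ _ _ _ _ _ _ {d = 0} _ _ _ _ ()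
    gaps _ _ _ _ _ _ _ {d = 1} _ _ _ _ _ = refl
    gaps _ _ _ _ _ _ _ {d = 2} _ _ _ _ ()
    gaps _ _ _ _ _ _ _ {d = 4} _ _ _ _ ()
    gaps {X} {p} {L} hic conn P 5≤L disj c₀ cL {k} {d@(suc (suc (suc (suc (suc _)))))} k+d≤L mk mkd clear odd-d
      with hic (shift P k k+d≤L) (s≤s (s≤s (s≤s (s≤s (s≤s z≤n))))) odd-d
             (λ i≤d → disj (≤-trans (+-monoʳ-≤ k i≤d) k+d≤L))
             (mark⁻ X p (subst (λ j → mark X p j ≡ true) (sym (+-identityʳ k)) mk)) (mark⁻ X p mkd)
    ... | i , 0<i , i<d , c = ⊥-elim (unmarked⁻ X p (clear 0<i i<d) c)
    gaps {X} {p} {L} hic conn P 5≤L disj c₀ cL {k} {3} k+3≤L mk mk3 clear _ = ⊥-elim absurd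
      where
      a = p (k + 1)
      b = p (k + 2)
      Q : Link (swap D) X a b
      Q = connect conn (disj (≤-trans (+-monoʳ-≤ k (s≤s z≤n)) k+3≤L))
            (disj (≤-trans (+-monoʳ-≤ k (s≤s (s≤s z≤n))) k+3≤L))
            (step (shift P k k+3≤L) (s≤s (s≤s z≤n)))
            (non-neighbour (disj (≤-trans (+-monoʳ-≤ k (s≤s z≤n)) k+3≤L)) (unmarked⁻ X p (clear (s≤s z≤n) (s≤s (s≤s z≤n)))))
            (non-neighbour (disj (≤-trans (+-monoʳ-≤ k (s≤s (s≤s z≤n))) k+3≤L)) (unmarked⁻ X p (clear (s≤s z≤n) (s≤s (s≤s (s≤s z≤n))))))
      S = shift P k k+3≤L
      ck : Complete D X (p (k + 0))
      ck = mark⁻ X p (subst (λ j → mark X p j ≡ true) (sym (+-identityʳ k)) mk)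
      away : 2 ≤ k + 1 ⊎ suc (k + 2) < L
      away = subst₂ (λ i j → 2 ≤ i ⊎ suc j < L) (+-comm 1 k) (trans (cong suc (+-comm 1 k)) (sym (+-suc k 1)))
               (near-start (suc k) 5≤L)
      absurd : ⊥
      absurd with odd (Link.L Q) in odd-Q
      ... | false = close₂ antihole Q (N-sym (far S {1} {3} ≤-refl ≤-refl)) (E-sym (step S ≤-refl)) (mark⁻ X p mk3)
                      (far S {0} {3} (s≤s (s≤s z≤n)) ≤-refl)
                      (far S {0} {2} ≤-refl (s≤s (s≤s z≤n))) (step S (s≤s z≤n)) ck odd-Q
      ... | true with far-end P away (≤-trans (+-monoʳ-≤ k (s≤s (s≤s z≤n))) k+3≤L)
      ...   | w , w≡ , wN = close₁ antihole Q (wN ≤-refl (+-monoʳ-≤ k (s≤s z≤n)))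
                              (wN (+-monoʳ-≤ k (s≤s z≤n)) ≤-refl) (Complete-end {p = p} c₀ cL w≡) odd-Q

  module Step
      (hole : OddHoleFree D) (antihole : OddHoleFree (swap D)) (no-leap : NoLeap D)
      (X : Subset n) (conn : Conn (swap D) X)
      (ih : ∀ {Y} → Y ⊂ X → Conn (swap D) Y → ∃ (_∈ Y) → HasInteriorComplete D Y)
      {p : ℕ → Fin n} {L : ℕ} (P : IndPath D p L) (5≤L : 5 ≤ L) (odd-L : odd L ≡ true)
      (disj : ∀ {i} → i ≤ L → p i ∉ X) (c₀ : Complete D X (p 0)) (cL : Complete D X (p L))
      (none : ∀ {i} → 0 < i → i < L → ¬ Complete D X (p i))
    where

    marks : ∀ {Y} → Y ⊂ X → Conn (swap D) Y → ∃ (_∈ Y) → Gaps (mark Y p) L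
    marks (Y⊆X , strict) connY ne = gaps antihole (ih (Y⊆X , strict) connY ne) connY P 5≤L
      (λ i≤L → disj i≤L ∘ Y⊆X) (c₀ ∘ Y⊆X) (cL ∘ Y⊆X)

    mark₀ : ∀ {Y} → Y ⊆ X → mark Y p 0 ≡ true
    mark₀ {Y} Y⊆X = mark⁺ Y p (c₀ ∘ Y⊆X)

    markL : ∀ {Y} → Y ⊆ X → mark Y p L ≡ true
    markL {Y} Y⊆X = mark⁺ Y p (cL ∘ Y⊆X)

    parity : ∀ {Y} → Y ⊂ X → Conn (swap D) Y → ∃ (_∈ Y) → edge-parity (mark Y p) L ≡ true
    parity Y⊂X connY ne = trans (edge-parity≡odd (marks Y⊂X connY ne) (mark₀ (proj₁ Y⊂X)) (markL (proj₁ Y⊂X))) odd-L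

    single-case : ∀ {x} → x ∈ X → (∀ {y} → y ∈ X → y ≡ x) → ⊥
    single-case {x} x∈ only = hole P (≤-trans (s≤s (s≤s z≤n)) 5≤L) (E-sym (c₀ x∈)) (E-sym (cL x∈))
      (λ {i} 0<i i<L → ¬E⇒N (λ { refl → disj (<⇒≤ i<L) x∈ })
        λ e → none 0<i i<L λ y∈ → subst (E (p i)) (sym (only y∈)) (E-sym e)) odd-L

    -- For x in X these are the internal vertices of P whose only non-neighbour in X is x, because
    -- no internal vertex is X-complete.
    I : Fin n → ℕ → Set
    I x i = 0 < i × i < L × Complete D (X ∖ x) (p i)

    module Removable {x y : Fin n} (x∈ : x ∈ X) (y∈ : y ∈ X) (xy : E x y)
                     (conn-x : Conn (swap D) (X ∖ x)) (conn-y : Conn (swap D) (X ∖ y)) where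

      W = X ∖ x ∖ y
      x∈X∖y : x ∈ X ∖ y
      x∈X∖y = ∈∖⁺ x∈ (E⇒≢ xy)
      y∈X∖x : y ∈ X ∖ x
      y∈X∖x = ∈∖⁺ y∈ (E⇒≢ xy ∘ sym)
      W⊆x : W ⊆ X ∖ x
      W⊆x = proj₁ ∘ ∈∖⁻
      W⊆y : W ⊆ X ∖ y
      W⊆y z∈ = ∈∖⁺ (proj₁ (∈∖⁻ (W⊆x z∈))) (proj₂ (∈∖⁻ z∈))

      hic-x : HasInteriorComplete D (X ∖ x)
      hic-x = ih (∖-⊂ x∈) conn-x (y , y∈X∖x)
      hic-y : HasInteriorComplete D (X ∖ y)
      hic-y = ih (∖-⊂ y∈) conn-y (x , x∈X∖y)

      I⇒N : ∀ {z i} → z ∈ X → I z i → N (p i) z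
      I⇒N z∈ (0<i , i<L , c) = ¬E⇒N (λ { refl → disj (<⇒≤ i<L) z∈ }) λ e → none 0<i i<L (Complete-insert c e)

      I≢ : ∀ {i j} → I x i → I y j → p i ≢ p j
      I≢ Ii (_ , _ , c) eq = excl (subst (λ v → E v x) (sym eq) (c x∈X∖y)) (I⇒N x∈ Ii)

      -- All I x – I y pairs are adjacent, so the edges of P complete to X ∖ x and
      -- to X ∖ y can only be its two end edges, which are too far apart.
      even-case : (Q : Link (swap D) W x y) → odd (Link.L Q) ≡ false → ⊥
      even-case Q even = ends (at-end x∈ conn-x y∈X∖x Ij₀ λ Ii → adjacent Ii (proj₂ Ij₀))
                              (at-end y∈ conn-y x∈X∖y Ii₀ λ Ij → E-sym (adjacent (proj₂ Ii₀) Ij))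
        where
        -- If nonadjacent, `p i` and `p j` would close the even antipath Q to an odd antihole.
        adjacent : ∀ {i j} → I x i → I y j → E (p i) (p j)
        adjacent Ii@(0<i , i<L , ci) Ij@(0<j , j<L , cj) = ¬N⇒E (I≢ Ii Ij) λ o →
          close₂ antihole Q (I⇒N x∈ Ii) (ci y∈X∖x) (ci ∘ W⊆x) (N-sym o) (I⇒N y∈ Ij) (cj x∈X∖y) (cj ∘ W⊆y) even
        Ii₀ : ∃ (I x)
        Ii₀ = hic-x P 5≤L odd-L (λ i≤L → disj i≤L ∘ proj₁ ∘ ∈∖⁻) (c₀ ∘ proj₁ ∘ ∈∖⁻) (cL ∘ proj₁ ∘ ∈∖⁻)
        Ij₀ : ∃ (I y)
        Ij₀ = hic-y P 5≤L odd-L (λ i≤L → disj i≤L ∘ proj₁ ∘ ∈∖⁻) (c₀ ∘ proj₁ ∘ ∈∖⁻) (cL ∘ proj₁ ∘ ∈∖⁻)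
        -- An inner edge complete to `X ∖ z` would form a triangle with `p j`, and an induced path
        -- has none.
        at-end : ∀ {z u v} → z ∈ X → Conn (swap D) (X ∖ z) → v ∈ X ∖ z → (J : ∃ (I u)) →
                 (∀ {i} → I z i → E (p i) (p (proj₁ J))) → ∃ λ i → I z i × (i ≡ 1 ⊎ suc i ≡ L)
        at-end {z} z∈ conn-z v∈ (j , _ , j<L , _) adj
          with edge-exists (mark (X ∖ z) p) L (parity (∖-⊂ z∈) conn-z (_ , v∈))
        ... | zero , _ , _ , m₁ = 1 , (s≤s z≤n , ≤-trans (s≤s (s≤s z≤n)) 5≤L , mark⁻ (X ∖ z) p m₁) , inj₁ refl
        ... | suc k , k<L , mk , mk′ with m≤n⇒m<n∨m≡n k<L
        ...   | inj₂ eq = suc k , (s≤s z≤n , k<L , mark⁻ (X ∖ z) p mk) , inj₂ eq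
        ...   | inj₁ k′<L with adjacent⇒consecutive P (<⇒≤ k<L) (<⇒≤ j<L) (adj (s≤s z≤n , k<L , mark⁻ (X ∖ z) p mk))
                         | adjacent⇒consecutive P k<L (<⇒≤ j<L) (adj (s≤s z≤n , k′<L , mark⁻ (X ∖ z) p mk′))
        ...     | inj₁ refl | inj₁ ()
        ...     | inj₁ refl | inj₂ ()
        ...     | inj₂ refl | inj₁ ()
        ...     | inj₂ refl | inj₂ ()
        ends : (∃ λ i → I x i × (i ≡ 1 ⊎ suc i ≡ L)) → (∃ λ j → I y j × (j ≡ 1 ⊎ suc j ≡ L)) → ⊥
        ends (i , Ii , ei) (j , Ij , ej) = apart 5≤L ei ej
          (adjacent⇒consecutive P (<⇒≤ (proj₁ (proj₂ Ii))) (<⇒≤ (proj₁ (proj₂ Ij))) (adjacent Ii Ij))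
          where
          apart : ∀ {L i j} → 5 ≤ L → i ≡ 1 ⊎ suc i ≡ L → j ≡ 1 ⊎ suc j ≡ L → suc i ≡ j ⊎ suc j ≡ i → ⊥
          apart _ (inj₁ refl) (inj₁ refl) (inj₁ ())
          apart _ (inj₁ refl) (inj₁ refl) (inj₂ ())
          apart (s≤s (s≤s (s≤s ()))) (inj₁ refl) (inj₂ refl) (inj₁ refl)
          apart (s≤s ()) (inj₂ refl) (inj₁ refl) (inj₁ refl)
          apart (s≤s (s≤s (s≤s ()))) (inj₂ refl) (inj₁ refl) (inj₂ refl)
          apart _ (inj₂ refl) (inj₂ refl) (inj₁ ())
          apart _ (inj₂ refl) (inj₂ refl) (inj₂ ())

      -- No I x – I y pair is adjacent, and the internal vertices complete to W are
      -- those of I x and I y: three odd numbers of edges, one the sum of the others.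
      odd-case : (Q : Link (swap D) W x y) → odd (Link.L Q) ≡ true → Conn (swap D) W → ∃ (_∈ W) → ⊥
      odd-case Q odd-Q conn-W ne-W = contradiction
        (trans (sym (parity W⊂X conn-W ne-W)) (trans (edge-parity-cong L marks-W)
          (trans (edge-parity-∨ L no-mixed)
            (cong₂ _xor_ (parity (∖-⊂ x∈) conn-x (y , y∈X∖x)) (parity (∖-⊂ y∈) conn-y (x , x∈X∖y))))))
        λ ()
        where
        W⊂X : W ⊂ X
        W⊂X = proj₁ ∘ ∈∖⁻ ∘ W⊆x , x , x∈ , λ x∈W → proj₂ (∈∖⁻ (W⊆x x∈W)) refl
        marks-W : ∀ {k} → k ≤ L → mark W p k ≡ mark (X ∖ x) p k ∨ mark (X ∖ y) p k
        marks-W {k} k≤L with complete? (X ∖ x) (p k) | complete? (X ∖ y) (p k)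
        ... | yes c | _     = mark⁺ W p (c ∘ W⊆x)
        ... | no _  | yes c = mark⁺ W p (c ∘ W⊆y)
        -- A W-complete vertex missing both x and y would close the odd antipath Q to an odd
        -- antihole.
        ... | no ¬cx | no ¬cy = unmarked⁺ W p λ c → close₁ antihole Q
          (¬E⇒N (λ { refl → disj k≤L x∈ }) λ e → ¬cy λ {z} z∈ → case z ≟ᶠ x of λ
            { (yes refl) → e ; (no z≢x) → c (∈∖⁺ (∈∖⁺ (proj₁ (∈∖⁻ z∈)) z≢x) (proj₂ (∈∖⁻ z∈))) })
          (¬E⇒N (λ { refl → disj k≤L y∈ }) λ e → ¬cx (Complete-insert c e))
          c odd-Q
        internal : ∀ {z k} → z ∈ X → k ≤ L → mark (X ∖ z) p k ≡ false → 0 < k × k < L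
        internal {z} {zero} z∈ _ eq = contradiction (trans (sym eq) (mark₀ {X ∖ z} (proj₁ ∘ ∈∖⁻))) λ ()
        internal {z} {suc k} z∈ k≤L eq = s≤s z≤n , ≤∧≢⇒< k≤L λ { refl →
          contradiction (trans (sym eq) (markL {X ∖ z} (proj₁ ∘ ∈∖⁻))) λ () }
        -- In the complement x, `p i`, w, `p j`, y is a path, and it closes the odd antipath Q.
        apart : ∀ {i j w} → I x i → I y j → E (p i) (p j) → w ≡ p 0 ⊎ w ≡ p L → N w (p i) → N w (p j) → ⊥
        apart Ii@(_ , _ , ci) Ij@(_ , _ , cj) e w≡ wi wj = close₃ antihole Q
          (I⇒N x∈ Ii) (ci y∈X∖x) (ci ∘ W⊆x)
          wi (cw x∈) (cw y∈) (cw ∘ proj₁ ∘ ∈∖⁻ ∘ W⊆x)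
          (N-sym wj) (I⇒N y∈ Ij) (E-sym e) (cj x∈X∖y) (cj ∘ W⊆y) odd-Q
          where
          cw : Complete D X _
          cw = Complete-end {p = p} c₀ cL w≡
        no-mixed : ∀ {k} → k < L → NoMixedEdge (mark (X ∖ x) p) (mark (X ∖ y) p) k
        no-mixed {k} k<L with far-end P (near-start k 5≤L) k<L
        ... | w , w≡ , wN = record
          { common = common k<L
          ; up = λ a b c d → apart (proj₁ (internal y∈ (<⇒≤ k<L) b) , k<L , mark⁻ (X ∖ x) p a)
                    (s≤s z≤n , proj₂ (internal x∈ k<L c) , mark⁻ (X ∖ y) p d)
                    (step P k<L) w≡ (wN ≤-refl (n≤1+n k)) (wN (n≤1+n k) ≤-refl)
          ; down = λ a b c d → apart (s≤s z≤n , proj₂ (internal y∈ k<L d) , mark⁻ (X ∖ x) p c)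
                    (proj₁ (internal x∈ (<⇒≤ k<L) a) , k<L , mark⁻ (X ∖ y) p b)
                    (E-sym (step P k<L)) w≡ (wN (n≤1+n k) ≤-refl) (wN ≤-refl (n≤1+n k)) }
          where
          both : ∀ {k} → 0 < k → k < L → mark (X ∖ x) p k ≡ true → mark (X ∖ y) p k ≡ true → ⊥
          both 0<k k<L a b = I≢ (0<k , k<L , mark⁻ (X ∖ x) p a) (0<k , k<L , mark⁻ (X ∖ y) p b) refl
          common : ∀ {k} → k < L → mark (X ∖ x) p k ≡ true → mark (X ∖ y) p k ≡ true →
                   mark (X ∖ x) p (suc k) ≡ true → mark (X ∖ y) p (suc k) ≡ true → ⊥
          common {zero} _ _ _ c d = both (s≤s z≤n) (≤-trans (s≤s (s≤s z≤n)) 5≤L) c d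
          common {suc k} k<L a b _ _ = both (s≤s z≤n) k<L a b

      removable-case : (∃ λ z → z ∈ X × N x z × N y z) ⊎ Conn (swap D) W → ⊥
      removable-case (inj₁ (z , z∈ , xz , yz)) = even-case (record
        { p = x ◂ z ◂ const y ; L = 2
        ; path = record
          { step = λ { {0} _ → xz ; {1} _ → N-sym yz ; {suc (suc _)} (s≤s (s≤s ())) }
          ; far = λ { {0} {1} (s≤s ()) ; {0} {2} _ _ → xy ; {0} {suc (suc (suc _))} _ (s≤s (s≤s ()))
                    ; {suc _} {1} (s≤s ()) ; {suc _} {2} (s≤s (s≤s ()))
                    ; {suc _} {suc (suc (suc _))} _ (s≤s (s≤s ())) } }
        ; 2≤L = ≤-refl ; start = refl ; finish = refl
        ; interior = λ { {1} _ _ → ∈∖⁺ (∈∖⁺ z∈ (N⇒≢ xz ∘ sym)) (N⇒≢ yz ∘ sym)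
                       ; {suc (suc _)} _ (s≤s (s≤s ())) } }) refl
      removable-case (inj₂ conn-W) = by-parity link
        where
        neighbour : ∀ {u v} → u ∈ X → v ∈ X → E u v → ∃ λ z → z ∈ X × z ≢ u × z ≢ v × N u z
        neighbour {u} {v} u∈ v∈ uv with crossing (swap D) ⁅ u ⁆ (conn u∈ v∈) (x∈⁅x⁆ u)
                                          (λ v∈u → E⇒≢ uv (sym (x∈⁅y⁆⇒x≡y u v∈u)))
        ... | w , z , _ , z∈ , w∈u , z∉u , wz rewrite x∈⁅y⁆⇒x≡y u w∈u =
          z , z∈ , (λ { refl → N-irrefl wz }) , (λ { refl → excl uv wz }) , wz
        link : Link (swap D) W x y
        link with neighbour x∈ y∈ xy | neighbour y∈ x∈ (E-sym xy)
        ... | z , z∈ , z≢x , z≢y , xz | z′ , z′∈ , z′≢y , z′≢x , yz′ =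
          connect conn-W (λ x∈W → proj₂ (∈∖⁻ (W⊆x x∈W)) refl) (λ y∈W → proj₂ (∈∖⁻ y∈W) refl) xy
            (z , ∈∖⁺ (∈∖⁺ z∈ z≢x) z≢y , xz) (z′ , ∈∖⁺ (∈∖⁺ z′∈ z′≢x) z′≢y , yz′)
        by-parity : Link (swap D) W x y → ⊥
        by-parity Q with odd (Link.L Q) in odd-Q
        ... | false = even-case Q odd-Q
        ... | true  = odd-case Q odd-Q conn-W (_ , Link.interior Q (s≤s z≤n) (Link.2≤L Q))

    module Clique {x y₀ : Fin n} (x∈ : x ∈ X) (y₀∈ : y₀ ∈ X) (y₀≢x : y₀ ≢ x)
                  (all-N : ∀ {u v} → u ∈ X → v ∈ X → u ≢ v → N u v) where

      Y = X ∖ x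
      Y⊆X : Y ⊆ X
      Y⊆X = proj₁ ∘ ∈∖⁻
      conn-Y : Conn (swap D) Y
      conn-Y {s} {t} s∈ t∈ with s ≟ᶠ t
      ... | yes refl = ε
      ... | no s≢t   = (s∈ , t∈ , all-N (Y⊆X s∈) (Y⊆X t∈) s≢t) ◅ ε
      y₀∈Y : y₀ ∈ Y
      y₀∈Y = ∈∖⁺ y₀∈ y₀≢x
      x⊂X : ⁅ x ⁆ ⊂ X
      x⊂X = (λ z∈ → subst (_∈ X) (sym (x∈⁅y⁆⇒x≡y x z∈)) x∈) , y₀ , y₀∈ , y₀≢x ∘ x∈⁅y⁆⇒x≡y x
      xN : ∀ {y} → y ∈ Y → N x y
      xN y∈ = all-N x∈ (Y⊆X y∈) (proj₂ (∈∖⁻ y∈) ∘ sym)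
      m₁ m₂ : ℕ → Bool
      m₁ = mark ⁅ x ⁆ p
      m₂ = mark Y p

      marked⇒E : ∀ {k} → m₁ k ≡ true → E x (p k)
      marked⇒E eq = E-sym (mark⁻ ⁅ x ⁆ p eq (x∈⁅x⁆ x))

      unmarked⇒N : ∀ {k} → k ≤ L → m₁ k ≡ false → N x (p k)
      unmarked⇒N {k} k≤L eq = ¬E⇒N (λ { refl → disj k≤L x∈ }) λ e →
        unmarked⁻ ⁅ x ⁆ p eq λ z∈ → subst (E (p k)) (sym (x∈⁅y⁆⇒x≡y x z∈)) (E-sym e)

      -- Prefixing w and x gives an odd path with Y-complete ends and no Y-complete vertex inside,
      -- against induction on Y. For d = 1 it is too short, but then a non-neighbour of `q 0` in Y
      -- completes a five-hole.
      mixed : ∀ {q d w} → IndPath D q d → odd d ≡ true → (∀ {i} → i ≤ d → q i ∉ X) →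
              E x (q 0) → ¬ Complete D Y (q 0) → N x (q d) → Complete D Y (q d) →
              (∀ {i} → 0 < i → i < d → N x (q i) × ¬ Complete D Y (q i)) →
              Complete D X w → (∀ {i} → i ≤ d → N w (q i)) → ⊥
      mixed {d = 0} _ () _ _ _ _ _ _ _ _
      mixed {d = 2} _ () _ _ _ _ _ _ _ _
      mixed {q} {1} Q _ disj-q x₀ ¬c₀ xd cd _ cw wN with non-neighbour (disj-q z≤n ∘ Y⊆X) ¬c₀
      ... | y , y∈ , q₀y = no-five-hole hole x₀ (step Q (s≤s z≤n)) (cd y∈) (E-sym (cw (Y⊆X y∈))) (cw x∈)
        xd (xN y∈) q₀y (wN z≤n) (wN ≤-refl)
      mixed {q} {d@(suc (suc (suc _)))} {w} Q odd-d disj-q x₀ ¬c₀ xd cd between cw wN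
        with ih (∖-⊂ x∈) conn-Y (y₀ , y₀∈Y)
          (cons (cons Q x₀ λ 0<j j≤d → case m≤n⇒m<n∨m≡n j≤d of λ
                  { (inj₁ j<d) → proj₁ (between 0<j j<d) ; (inj₂ refl) → xd })
                (cw x∈) λ { {suc j} _ (s≤s j≤d) → wN j≤d })
          (s≤s (s≤s (s≤s (s≤s (s≤s z≤n))))) (cong (not ∘ not) odd-d)
          (λ { {0} _ w∈ → E-irrefl (cw (Y⊆X w∈)) ; {1} _ x∈Y → proj₂ (∈∖⁻ x∈Y) refl
             ; {suc (suc i)} (s≤s (s≤s i≤d)) → disj-q i≤d ∘ Y⊆X })
          (cw ∘ Y⊆X) cd
      ... | 0 , () , _
      ... | 1 , _ , _ , c = excl (c y₀∈Y) (xN y₀∈Y)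
      ... | 2 , _ , _ , c = ¬c₀ c
      ... | suc (suc (suc i)) , _ , s≤s (s≤s i<d) , c = proj₂ (between (s≤s z≤n) i<d) c

      Clear : ℕ → ℕ → Set
      Clear k d = ∀ {i} → 0 < i → i < d → m₁ (k + i) ≡ false × m₂ (k + i) ≡ false

      mixed-up : ∀ {k d} → k + d ≤ L → odd d ≡ true → m₁ k ≡ true → m₂ k ≡ false →
                 m₁ (k + d) ≡ false → m₂ (k + d) ≡ true → Clear k d → 2 ≤ k ⊎ suc (k + d) < L → ⊥
      mixed-up {k} {d} k+d≤L odd-d a b c e clear away with far-end P away k+d≤L
      ... | w , w≡ , wN = mixed (shift P k k+d≤L) odd-d (λ i≤d → disj (≤-trans (+-monoʳ-≤ k i≤d) k+d≤L))
        (subst (E x ∘ p) (sym (+-identityʳ k)) (marked⇒E a))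
        (subst (λ j → ¬ Complete D Y (p j)) (sym (+-identityʳ k)) (unmarked⁻ Y p b))
        (unmarked⇒N k+d≤L c) (mark⁻ Y p e)
        (λ 0<i i<d → unmarked⇒N (≤-trans (+-monoʳ-≤ k (<⇒≤ i<d)) k+d≤L) (proj₁ (clear 0<i i<d)) ,
                     unmarked⁻ Y p (proj₂ (clear 0<i i<d)))
        (Complete-end {p = p} c₀ cL w≡) (λ {i} i≤d → wN (m≤m+n k i) (+-monoʳ-≤ k i≤d))

      mixed-down : ∀ {k d} → k + d ≤ L → odd d ≡ true → m₁ k ≡ false → m₂ k ≡ true →
                   m₁ (k + d) ≡ true → m₂ (k + d) ≡ false → Clear k d → 2 ≤ k ⊎ suc (k + d) < L → ⊥
      mixed-down {k} {d} k+d≤L odd-d a b c e clear away with far-end P away k+d≤L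
      ... | w , w≡ , wN = mixed (rev (shift P k k+d≤L)) odd-d (λ {i} _ → disj (≤-trans (+-monoʳ-≤ k (m∸n≤m d i)) k+d≤L))
        (marked⇒E c) (unmarked⁻ Y p e)
        (subst (N x ∘ p) (sym last) (unmarked⇒N (≤-trans (m≤m+n k d) k+d≤L) a))
        (subst (Complete D Y ∘ p) (sym last) (mark⁻ Y p b))
        (λ {i} 0<i i<d → let cl = clear (m<n⇒0<n∸m i<d) (∸-monoʳ-< {d} {i} {0} 0<i (<⇒≤ i<d)) in
           unmarked⇒N (≤-trans (+-monoʳ-≤ k (m∸n≤m d i)) k+d≤L) (proj₁ cl) , unmarked⁻ Y p (proj₂ cl))
        (Complete-end {p = p} c₀ cL w≡) (λ {i} i≤d → wN (m≤m+n k (d ∸ i)) (+-monoʳ-≤ k (m∸n≤m d i)))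
        where
        last : k + (d ∸ d) ≡ k
        last = trans (cong (k +_) (n∸n≡0 d)) (+-identityʳ k)

      -- The only odd mixed gap runs from one end of P to the other; it is a leap
      -- when Y is a single vertex.
      exceptional : ∀ {e f} → 0 < e → e < L → e ≢ f →
        (∀ {i} → 0 < i → i < L → i ≢ e → N x (p i)) → Complete D Y (p f) →
        (∀ {i} → 0 < i → i < L → i ≢ f → ¬ Complete D Y (p i)) →
        (∀ {y} → N x y → E y (p 0) → E y (p f) → E y (p L) →
          (∀ {i} → 0 < i → i < L → i ≢ f → N y (p i)) → ⊥) → ⊥
      exceptional {e} {f} 0<e e<L e≢f x-only cf Y-only leap
        with non-neighbour (disj (<⇒≤ e<L) ∘ Y⊆X) (Y-only 0<e e<L e≢f)
      ... | y , y∈ , ey with any? (λ z → (z ∈? Y) ×-dec ¬? (z ≟ᶠ y))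
      ...   | no none′ = leap (xN y∈) (E-sym (c₀ (Y⊆X y∈))) (E-sym (cf y∈)) (E-sym (cL (Y⊆X y∈)))
        λ {i} 0<i i<L i≢f → ¬E⇒N (λ { refl → disj (<⇒≤ i<L) (Y⊆X y∈) }) λ yi →
          Y-only 0<i i<L i≢f λ {z} z∈ → case z ≟ᶠ y of λ
            { (yes refl) → E-sym yi ; (no z≢y) → contradiction (z , z∈ , z≢y) none′ }
      -- With a second vertex z in Y, the pair x, y is a proper anticonnected subset of X. Induction
      -- yields an internal common neighbour, but the only internal neighbour of x is `p e`, and y
      -- was chosen to miss it.
      ...   | yes (z , z∈ , z≢y)
        with ih {⁅ x ⁆ ∪ ⁅ y ⁆}
               ((λ v∈ → case ∈-insert⁻ v∈ of λ { (inj₁ v∈x) → proj₁ x⊂X v∈x ; (inj₂ refl) → Y⊆X y∈ })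
               , z , Y⊆X z∈ , λ z∈′ → case ∈-insert⁻ z∈′ of λ
                   { (inj₁ z∈x) → proj₂ (∈∖⁻ z∈) (x∈⁅y⁆⇒x≡y x z∈x) ; (inj₂ z≡y) → z≢y z≡y })
               (Conn-insert (swap D) (Conn-singleton (swap D) x) (x∈⁅x⁆ x) (xN y∈))
               (x , ∈-insertˡ (x∈⁅x⁆ x)) P 5≤L odd-L
               (λ i≤L v∈ → case ∈-insert⁻ v∈ of λ
                 { (inj₁ v∈x) → disj i≤L (proj₁ x⊂X v∈x) ; (inj₂ eq) → disj i≤L (subst (_∈ X) (sym eq) (Y⊆X y∈)) })
               (λ v∈ → c₀ (case ∈-insert⁻ v∈ of λ { (inj₁ v∈x) → proj₁ x⊂X v∈x ; (inj₂ refl) → Y⊆X y∈ }))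
               (λ v∈ → cL (case ∈-insert⁻ v∈ of λ { (inj₁ v∈x) → proj₁ x⊂X v∈x ; (inj₂ refl) → Y⊆X y∈ }))
      ... | i , 0<i , i<L , c with i ≟ e
      ...   | yes refl = excl (c ∈-insertʳ) ey
      ...   | no i≢e   = excl (c (∈-insertˡ (x∈⁅x⁆ x))) (N-sym (x-only 0<i i<L i≢e))

      leap-at : ∀ {K M u v} → IndPath D p M → 5 ≤ M → suc K ≡ M → N u v →
        E u (p 0) → E u (p 1) → E u (p M) → (∀ {i} → 0 < i → i < M → i ≢ 1 → N u (p i)) →
        E v (p 0) → E v (p K) → E v (p M) → (∀ {i} → 0 < i → i < M → i ≢ K → N v (p i)) → ⊥
      leap-at P′ (s≤s 4≤K) refl uv u₀ u₁ uM uN v₀ vK vM vN = no-leap P′ 4≤K uv u₀ u₁ uM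
        (λ 1<i i≤K → uN (<⇒≤ 1<i) (s≤s i≤K) (<⇒≢ 1<i ∘ sym)) v₀ vK vM
        (λ 0<i i<K → vN 0<i (m≤n⇒m≤1+n i<K) (<⇒≢ i<K))

      spread : ∀ {d i} → suc (suc d) ≡ L → 0 < i → i < L → i ≡ 1 ⊎ i ≡ suc d ⊎ ∃ λ j → 0 < j × j < d × 1 + j ≡ i
      spread {d} {suc zero} eq _ _ = inj₁ refl
      spread {d} {suc (suc j)} eq _ i<L with m≤n⇒m<n∨m≡n (≤-pred (≤-pred (subst (suc (suc (suc j)) ≤_) (sym eq) i<L)))
      ... | inj₁ j<d  = inj₂ (inj₂ (suc j , s≤s z≤n , j<d , refl))
      ... | inj₂ refl = inj₂ (inj₁ refl)

      2≤d : ∀ {d} → suc (suc d) ≡ L → 2 ≤ d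
      2≤d eq = ≤-trans (s≤s (s≤s z≤n)) (≤-pred (≤-pred (subst (5 ≤_) (sym eq) 5≤L)))

      exceptional-up : ∀ {d} → suc (suc d) ≡ L → m₁ 1 ≡ true → m₂ 1 ≡ false →
                       m₁ (suc d) ≡ false → m₂ (suc d) ≡ true → Clear 1 d → ⊥
      exceptional-up {d} eq a b c e clear = exceptional {1} {suc d}
        (s≤s z≤n) (≤-trans (s≤s (s≤s z≤n)) 5≤L) (<⇒≢ (s≤s (<⇒≤ (2≤d eq)))) x-only
        (mark⁻ Y p e)
        (λ 0<i i<L i≢ → case spread eq 0<i i<L of λ
          { (inj₁ refl) → unmarked⁻ Y p b
          ; (inj₂ (inj₁ refl)) → contradiction refl i≢
          ; (inj₂ (inj₂ (j , 0<j , j<d , refl))) → unmarked⁻ Y p (proj₂ (clear 0<j j<d)) })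
        λ xy y₀ yf yL y-only → leap-at P 5≤L eq xy (E-sym (c₀ x∈)) (marked⇒E a) (E-sym (cL x∈)) x-only
                                 y₀ yf yL y-only
        where
        x-only : ∀ {i} → 0 < i → i < L → i ≢ 1 → N x (p i)
        x-only 0<i i<L i≢1 with spread eq 0<i i<L
        ... | inj₁ refl = contradiction refl i≢1
        ... | inj₂ (inj₁ refl) = unmarked⇒N (<⇒≤ i<L) c
        ... | inj₂ (inj₂ (j , 0<j , j<d , refl)) = unmarked⇒N (<⇒≤ i<L) (proj₁ (clear 0<j j<d))

      exceptional-down : ∀ {d} → suc (suc d) ≡ L → m₁ 1 ≡ false → m₂ 1 ≡ true →
                         m₁ (suc d) ≡ true → m₂ (suc d) ≡ false → Clear 1 d → ⊥
      exceptional-down {d} eq a b c e clear = exceptional {suc d} {1}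
        (s≤s z≤n) (subst (suc d <_) eq ≤-refl) (<⇒≢ (s≤s (<⇒≤ (2≤d eq))) ∘ sym) x-only
        (mark⁻ Y p b)
        (λ 0<i i<L i≢ → case spread eq 0<i i<L of λ
          { (inj₁ refl) → contradiction refl i≢
          ; (inj₂ (inj₁ refl)) → unmarked⁻ Y p e
          ; (inj₂ (inj₂ (j , 0<j , j<d , refl))) → unmarked⁻ Y p (proj₂ (clear 0<j j<d)) })
        λ xy y₀ yf yL y-only → leap-at P 5≤L eq (N-sym xy) y₀ yf yL y-only
                                 (E-sym (c₀ x∈)) (marked⇒E c) (E-sym (cL x∈)) x-only
        where
        x-only : ∀ {i} → 0 < i → i < L → i ≢ suc d → N x (p i)
        x-only 0<i i<L i≢ with spread eq 0<i i<L
        ... | inj₁ refl = unmarked⇒N (<⇒≤ i<L) a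
        ... | inj₂ (inj₁ refl) = contradiction refl i≢
        ... | inj₂ (inj₂ (j , 0<j , j<d , refl)) = unmarked⇒N (<⇒≤ i<L) (proj₁ (clear 0<j j<d))

      -- Both ends of P carry both marks, so a mixed gap lies strictly inside P; it comes near both
      -- ends only if it is the entire interior.
      at-ends : ∀ {k d} → k + d ≤ L → m₁ k ≡ false ⊎ m₂ k ≡ false → m₁ (k + d) ≡ false ⊎ m₂ (k + d) ≡ false →
                (2 ≤ k ⊎ suc (k + d) < L) ⊎ (k ≡ 1 × suc (suc d) ≡ L)
      at-ends {zero} _ (inj₁ a) _ = contradiction (trans (sym a) (mark₀ (proj₁ x⊂X))) λ ()
      at-ends {zero} _ (inj₂ b) _ = contradiction (trans (sym b) (mark₀ Y⊆X)) λ ()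
      at-ends {suc (suc k)} _ _ _ = inj₁ (inj₁ (s≤s (s≤s z≤n)))
      at-ends {suc zero} {d} k+d≤L _ end with m≤n⇒m<n∨m≡n k+d≤L
      ... | inj₂ refl = ⊥-elim ([ (λ a → contradiction (trans (sym a) (markL (proj₁ x⊂X))) λ ())
                                , (λ b → contradiction (trans (sym b) (markL Y⊆X)) λ ()) ]′ end)
      ... | inj₁ lt with m≤n⇒m<n∨m≡n lt
      ...   | inj₁ lt′ = inj₁ (inj₂ lt′)
      ...   | inj₂ eq  = inj₂ (refl , eq)

      gaps-∨ : Gaps (λ k → m₁ k ∨ m₂ k) L
      gaps-∨ {k} {d} k+d≤L mk mkd clear odd-d =
        by-type (m₁ k) (m₂ k) (m₁ (k + d)) (m₂ (k + d)) refl refl refl refl mk mkd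
        where
        both-false : ∀ {a b} → a ∨ b ≡ false → a ≡ false × b ≡ false
        both-false {false} {false} _ = refl , refl
        clear′ : Clear k d
        clear′ 0<i i<d = both-false (clear 0<i i<d)
        up : m₁ k ≡ true → m₂ k ≡ false → m₁ (k + d) ≡ false → m₂ (k + d) ≡ true → ⊥
        up a b c e with at-ends {k} {d} k+d≤L (inj₂ b) (inj₁ c)
        ... | inj₁ away = mixed-up k+d≤L odd-d a b c e clear′ away
        ... | inj₂ (refl , eq) = exceptional-up eq a b c e clear′
        down : m₁ k ≡ false → m₂ k ≡ true → m₁ (k + d) ≡ true → m₂ (k + d) ≡ false → ⊥
        down a b c e with at-ends {k} {d} k+d≤L (inj₁ a) (inj₂ e)
        ... | inj₁ away = mixed-down k+d≤L odd-d a b c e clear′ away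
        ... | inj₂ (refl , eq) = exceptional-down eq a b c e clear′
        by-type : ∀ a b c e → m₁ k ≡ a → m₂ k ≡ b → m₁ (k + d) ≡ c → m₂ (k + d) ≡ e →
                  m₁ k ∨ m₂ k ≡ true → m₁ (k + d) ∨ m₂ (k + d) ≡ true → d ≡ 1
        by-type true _ true _ a b c e _ _ = marks x⊂X (Conn-singleton (swap D) x) (x , x∈⁅x⁆ x) k+d≤L a c
          (λ 0<i i<d → proj₁ (clear′ 0<i i<d)) odd-d
        by-type _ true _ true a b c e _ _ = marks (∖-⊂ x∈) conn-Y (y₀ , y₀∈Y) k+d≤L b e
          (λ 0<i i<d → proj₂ (clear′ 0<i i<d)) odd-d
        by-type true false false true a b c e _ _ = ⊥-elim (up a b c e)
        by-type false true true false a b c e _ _ = ⊥-elim (down a b c e)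
        by-type false false _ _ a b c e f g = contradiction (trans (sym f) (cong₂ _∨_ a b)) λ ()
        by-type _ _ false false a b c e f g = contradiction (trans (sym g) (cong₂ _∨_ c e)) λ ()

      -- The marked edges for the union are odd in number by `gaps-∨`, but also the sum of two odd
      -- numbers. A mixed edge would be a mixed gap of length 1.
      clique-case : ⊥
      clique-case = contradiction
        (trans (sym odd-L) (trans (sym (edge-parity≡odd gaps-∨
            (cong (_∨ m₂ 0) (mark₀ (proj₁ x⊂X))) (cong (_∨ m₂ L) (markL (proj₁ x⊂X)))))
          (trans (edge-parity-∨ L no-mixed)
            (cong₂ _xor_ (parity x⊂X (Conn-singleton (swap D) x) (x , x∈⁅x⁆ x))
                         (parity (∖-⊂ x∈) conn-Y (y₀ , y₀∈Y))))))
        λ ()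
        where
        both : ∀ {k} → 0 < k → k < L → m₁ k ≡ true → m₂ k ≡ true → ⊥
        both 0<k k<L a b = none 0<k k<L (Complete-insert (mark⁻ Y p b) (E-sym (marked⇒E a)))
        common : ∀ {k} → k < L → m₁ k ≡ true → m₂ k ≡ true → m₁ (suc k) ≡ true → m₂ (suc k) ≡ true → ⊥
        common {zero} _ _ _ c d = both (s≤s z≤n) (≤-trans (s≤s (s≤s z≤n)) 5≤L) c d
        common {suc k} k<L a b _ _ = both (s≤s z≤n) k<L a b
        no-mixed : ∀ {k} → k < L → NoMixedEdge m₁ m₂ k
        no-mixed {k} k<L = record
          { common = common k<L
          ; up = subst (λ j → m₁ k ≡ true → m₂ k ≡ false → m₁ j ≡ false → m₂ j ≡ true → ⊥) k+1
                   λ a b c d → mixed-up k+1≤L refl a b c d no-clear away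
          ; down = subst (λ j → m₁ k ≡ false → m₂ k ≡ true → m₁ j ≡ true → m₂ j ≡ false → ⊥) k+1
                   λ a b c d → mixed-down k+1≤L refl a b c d no-clear away }
          where
          k+1 : k + 1 ≡ suc k
          k+1 = +-comm k 1
          k+1≤L : k + 1 ≤ L
          k+1≤L = subst (_≤ L) (sym k+1) k<L
          away : 2 ≤ k ⊎ suc (k + 1) < L
          away = subst (λ j → 2 ≤ k ⊎ suc j < L) (sym k+1) (near-start k 5≤L)
          no-clear : Clear k 1
          no-clear (s≤s _) (s≤s ())

  module _ (hole : OddHoleFree D) (antihole : OddHoleFree (swap D)) (no-leap : NoLeap D) where

    -- The Roussel–Rubio lemma without its leap alternative, which gives a long prism.
    roussel-rubio : ∀ {X} → Acc _⊂_ X → Conn (swap D) X → ∃ (_∈ X) → HasInteriorComplete D X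
    roussel-rubio {X} (acc rs) conn ne {p} {L} P 5≤L odd-L disj c₀ cL
      with anyUpTo? (λ i → (0 <? i) ×-dec complete? X (p i)) L
    ... | yes (i , i<L , 0<i , c) = i , 0<i , i<L , c
    ... | no none = ⊥-elim (by-shape (shape (swap D) conn ne))
      where
      open Step hole antihole no-leap X conn (λ Y⊂X → roussel-rubio (rs Y⊂X)) P 5≤L odd-L disj c₀ cL
             (λ 0<i i<L c → none (_ , i<L , 0<i , c))
      by-shape : Shape (swap D) X → ⊥
      by-shape (single x∈ only) = single-case x∈ only
      by-shape (clique x∈ y∈ y≢x all-N) = Clique.clique-case x∈ y∈ y≢x all-N
      by-shape (removable x∈ y∈ xy conn-x conn-y alt) =
        Removable.removable-case x∈ y∈ xy conn-x conn-y alt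

    short-antipath : ∀ {X p L} → Conn (swap D) X → ∃ (_∈ X) → IndPath D p L → 3 ≤ L → odd L ≡ true →
      Complete D X (p 0) → Complete D X (p L) →
      (∀ {i} → 0 < i → i < L → p i ∉ X × ∃ λ x → x ∈ X × N (p i) x) →
      L ≡ 3 × Σ (Link (swap D) X (p 1) (p 2)) λ Q → odd (Link.L Q) ≡ true
    short-antipath {L = 0} _ _ _ () _ _ _ _
    short-antipath {L = 1} _ _ _ (s≤s ()) _ _ _ _
    short-antipath {L = 2} _ _ _ _ () _ _ _
    short-antipath {L = 4} _ _ _ _ () _ _ _
    short-antipath {X} {p} {3} conn ne P _ _ c₀ c₃ missing = refl , Q , odd-Q
      where
      missing₁ = missing {1} (s≤s z≤n) (s≤s (s≤s z≤n))
      missing₂ = missing {2} (s≤s z≤n) ≤-refl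
      Q : Link (swap D) X (p 1) (p 2)
      Q = connect conn (proj₁ missing₁) (proj₁ missing₂) (step P (s≤s (s≤s z≤n))) (proj₂ missing₁) (proj₂ missing₂)
      odd-Q : odd (Link.L Q) ≡ true
      odd-Q with odd (Link.L Q) in eq
      ... | true  = refl
      -- An even antipath between the middle vertices would close with the two ends of P.
      ... | false = ⊥-elim (close₂ antihole Q (N-sym (far P {1} {3} ≤-refl ≤-refl)) (E-sym (step P ≤-refl)) c₃
                      (far P {0} {3} (s≤s (s≤s z≤n)) ≤-refl) (far P {0} {2} ≤-refl (s≤s (s≤s z≤n)))
                      (step P (s≤s z≤n)) c₀ eq)
    short-antipath {X} {p} {L@(suc (suc (suc (suc (suc _)))))} conn ne P _ odd-L c₀ cL missing
      with roussel-rubio (⊂-wellFounded X) conn ne P (s≤s (s≤s (s≤s (s≤s (s≤s z≤n))))) odd-L disj c₀ cL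
      where
      disj : ∀ {i} → i ≤ L → p i ∉ X
      disj {zero} _ = Complete⇒∉ c₀
      disj {suc i} i≤L with m≤n⇒m<n∨m≡n i≤L
      ... | inj₁ i<L  = proj₁ (missing (s≤s z≤n) i<L)
      ... | inj₂ refl = Complete⇒∉ cL
    ... | i , 0<i , i<L , c with proj₂ (missing 0<i i<L)
    ...   | x , x∈ , o = contradiction o (excl (c x∈))

-- Loose skew partitions

record Good {n : ℕ} (D : Duo n) : Set where
  field
    hole      : OddHoleFree D
    antihole  : OddHoleFree (swap D)
    no-leap   : NoLeap D
    no-coleap : NoLeap (swap D)

swap-good : ∀ {n} {D : Duo n} → Good D → Good (swap D)
swap-good g = record { hole = antihole ; antihole = hole ; no-leap = no-coleap ; no-coleap = no-leap }
  where open Good g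

module _ {n : ℕ} (D : Duo n) where
  open Duo D

  record Induces {k : ℕ} (K : Graph k) (f : Fin k → Fin n) : Set where
    field
      edge     : ∀ {i j} → Graph._∼_ K i j → E (f i) (f j)
      non-edge : ∀ {i j} → i ≢ j → ¬ Graph._∼_ K i j → N (f i) (f j)

  -- This is the part of the matrix M above its diagonal, row by row, so that an explicit induced
  -- subgraph is given with each pair listed once.
  Triangle : ∀ {k} → (Fin k → Fin k → Bool) → (Fin k → Fin n) → Set
  Triangle {zero}  M f = ⊤
  Triangle {suc k} M f = (∀ j → if M zero (suc j) then E (f zero) (f (suc j)) else N (f zero) (f (suc j)))
                       × Triangle (λ i j → M (suc i) (suc j)) (f ∘ suc)

  record SkewSplit (A B : Subset n) : Set where
    field
      cover   : ∀ v → v ∈ A ⊎ v ∈ B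
      disjoint : ∀ {v} → v ∈ A → v ∉ B
      A-disc  : ∃₂ λ s t → s ∈ A × t ∈ A × ¬ Walk D A s t
      B-disc  : ∃₂ λ s t → s ∈ B × t ∈ B × ¬ Walk (swap D) B s t

  NoOddPath : Subset n → Subset n → Set
  NoOddPath A B = ∀ {p L} → IndPath D p L → 3 ≤ L → odd L ≡ true → p 0 ∈ B → p L ∈ B →
                  (∀ {i} → 0 < i → i < L → p i ∈ A) → ⊥

  -- A loose skew partition up to the choice of sides: X is a component of A, Y an
  -- anticomponent of B, and b may be put on either side.
  record Loose : Set where
    field
      {X Y}  : Subset n
      {b c}  : Fin n
      connX  : Conn D X
      connY  : Conn (swap D) Y
      neX    : ∃ (_∈ X)
      neY    : ∃ (_∈ Y)
      X∩Y    : ∀ {v} → v ∈ X → v ∉ Y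
      bX     : Complete (swap D) X b
      bY     : Complete D Y b
      c∉X    : c ∉ X
      c∉Y    : c ∉ Y
      c≢b    : c ≢ b
      other  : ∀ {v} → v ∉ X → v ∉ Y → Complete (swap D) X v ⊎ Complete D Y v

  -- This is what minimality of X and Y provides; over `swap D` the second alternative supplies
  -- neighbours instead of non-neighbours.
  OneOrMissing : Subset n → Subset n → Set
  OneOrMissing X Y = (∀ {x x′} → x ∈ X → x′ ∈ X → x ≡ x′) ⊎ (∀ {x} → x ∈ X → ∃ λ y → y ∈ Y × N x y)

triangle⇒induces : ∀ {n} (D : Duo n) {k} (K : Graph k) (f : Fin k → Fin n) →
  Triangle D (λ i j → does (Graph._∼?_ K i j)) f → Induces D K f
triangle⇒induces {n} D K f tr = record
  { edge = λ {i} {j} e → case i ≟ᶠ j of λ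
      { (yes refl) → contradiction e (∼-irrefl refl)
      ; (no i≢j) → proj₁ (full M M-sym f tr i≢j) (dec-true (i ∼? j) e) }
  ; non-edge = λ {i} {j} i≢j ¬e → proj₂ (full M M-sym f tr i≢j) (dec-false (i ∼? j) ¬e) }
  where
  open Duo D
  open Graph K
  M : Fin _ → Fin _ → Bool
  M i j = does (i ∼? j)
  M-sym : ∀ i j → M i j ≡ M j i
  M-sym i j with i ∼? j | j ∼? i
  ... | yes _ | yes _ = refl
  ... | no _  | no _  = refl
  ... | yes e | no ¬e = contradiction (∼-sym e) ¬e
  ... | no ¬e | yes e = contradiction (∼-sym e) ¬e
  full : ∀ {k} (M : Fin k → Fin k → Bool) → (∀ i j → M i j ≡ M j i) → (f : Fin k → Fin n) →
         Triangle D M f → ∀ {i j} → i ≢ j →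
         (M i j ≡ true → E (f i) (f j)) × (M i j ≡ false → N (f i) (f j))
  full M M-sym f (row , rows) {zero} {zero} i≢j = contradiction refl i≢j
  full M M-sym f (row , rows) {zero} {suc j} i≢j with M zero (suc j) | row j
  ... | true  | e = const e , λ ()
  ... | false | o = (λ ()) , const o
  full M M-sym f (row , rows) {suc i} {zero} i≢j rewrite M-sym (suc i) zero with M zero (suc i) | row i
  ... | true  | e = const (E-sym e) , λ ()
  ... | false | o = (λ ()) , const (N-sym o)
  full M M-sym f (row , rows) {suc i} {suc j} i≢j =
    full (λ i j → M (suc i) (suc j)) (λ i j → M-sym (suc i) (suc j)) (f ∘ suc) rows (i≢j ∘ cong suc)

swap-loose : ∀ {n} {D : Duo n} → Loose D → Loose (swap D)
swap-loose l = record
  { connX = connY ; connY = connX ; neX = neY ; neY = neX ; X∩Y = λ y∈ x∈ → X∩Y x∈ y∈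
  ; bX = bY ; bY = bX ; c∉X = c∉Y ; c∉Y = c∉X ; c≢b = c≢b ; other = λ v∉Y v∉X → Sum.swap (other v∉X v∉Y) }
  where open Loose l

odd-link≥3 : ∀ {n} {D : Duo n} {S u v} (Q : Link D S u v) → odd (Link.L Q) ≡ true → 3 ≤ Link.L Q
odd-link≥3 Q odd-Q with m≤n⇒m<n∨m≡n (Link.2≤L Q)
... | inj₁ lt = lt
... | inj₂ eq = contradiction (trans (sym odd-Q) (cong odd (sym eq))) λ ()

module _ {n : ℕ} {D : Duo n} where
  open Duo D
  open IndPath

  one-side : ∀ {S T : Subset n} {p L} → (∀ {s t} → s ∈ S → t ∈ T → N s t) → IndPath D p L → 2 ≤ L →
             (∀ {i} → 0 < i → i < L → p i ∈ S ⊎ p i ∈ T) →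
             (∀ {i} → 0 < i → i < L → p i ∈ S) ⊎ (∀ {i} → 0 < i → i < L → p i ∈ T)
  one-side {p = p} {L} apart P 2≤L int = Sum.map (λ s → go apart int s) (λ t →
      go (λ t∈ s∈ → N-sym (apart s∈ t∈)) (λ 0<i i<L → Sum.swap (int 0<i i<L)) t)
    (int (s≤s z≤n) 2≤L)
    where
    go : ∀ {S T : Subset n} → (∀ {s t} → s ∈ S → t ∈ T → N s t) →
         (∀ {i} → 0 < i → i < L → p i ∈ S ⊎ p i ∈ T) → p 1 ∈ S → ∀ {i} → 0 < i → i < L → p i ∈ S
    go {S} apart int p₁ {suc i} _ = from-1 i
      where
      from-1 : ∀ i → suc i < L → p (suc i) ∈ S
      from-1 zero    _ = p₁
      from-1 (suc i) i<L with int (s≤s z≤n) i<L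
      ... | inj₁ s = s
      ... | inj₂ t = contradiction (apart (from-1 i (<⇒≤ i<L)) t) (excl (step P (<⇒≤ i<L)))

  ends-apart : ∀ {p L} → IndPath D p L → 3 ≤ L → N (p 0) (p L)
  ends-apart P 3≤L = far P (≤-trans (s≤s (s≤s z≤n)) 3≤L) ≤-refl

  -- A new path between the same ends is linked through X, and `theta` forces it to have the parity
  -- of the old one.
  via : ∀ {X p L} → OddHoleFree D → Conn D X → IndPath D p L → 3 ≤ L → odd L ≡ true →
        p 0 ∉ X → p L ∉ X → ∃ (λ x → x ∈ X × E (p 0) x) → ∃ (λ x → x ∈ X × E (p L) x) →
        (∀ {i} → 0 < i → i < L → Complete (swap D) X (p i)) →
        Σ (Link D X (p 0) (p L)) λ Q → odd (Link.L Q) ≡ true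
  via {X} {p} {L} hole conn P 3≤L odd-L p₀∉ pL∉ nb₀ nbL int = Q , trans (sym same) odd-L
    where
    Q : Link D X (p 0) (p L)
    Q = connect conn p₀∉ pL∉ (ends-apart P 3≤L) nb₀ nbL
    same : odd L ≡ odd (Link.L Q)
    same = theta hole P (Link.path Q) (≤-trans (n≤1+n 2) 3≤L) (Link.2≤L Q) (sym (Link.start Q)) (sym (Link.finish Q))
      λ 0<i i<L 0<j j<M → int 0<i i<L (Link.interior Q 0<j j<M)

  through-one : ∀ {X : Subset n} {p L} → IndPath D p L → 3 ≤ L → (∀ {i} → 0 < i → i < L → p i ∈ X) →
                (∀ {x x′} → x ∈ X → x′ ∈ X → x ≡ x′) → ⊥
  through-one P 3≤L int one = E⇒≢ (step P (≤-trans (s≤s (s≤s z≤n)) 3≤L))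
    (one (int (s≤s z≤n) (≤-trans (s≤s (s≤s z≤n)) 3≤L)) (int (s≤s z≤n) 3≤L))

  module _ (good : Good D) where
    open Good good

    -- The odd antipath through Y between the middle vertices closes with b, which misses these two
    -- vertices of X and is complete to Y.
    crossing-path : ∀ {X Y b p L} → Conn (swap D) Y → ∃ (_∈ Y) → (∀ {v} → v ∈ X → v ∉ Y) →
      Complete (swap D) X b → Complete D Y b → OneOrMissing D X Y →
      IndPath D p L → 3 ≤ L → odd L ≡ true → Complete D Y (p 0) → Complete D Y (p L) →
      (∀ {i} → 0 < i → i < L → p i ∈ X) → ⊥
    crossing-path _ _ _ _ _ (inj₁ one) P 3≤L _ _ _ int = through-one P 3≤L int one
    crossing-path {Y = Y} {p = p} {L} connY neY X∩Y bX bY (inj₂ missing) P 3≤L odd-L c₀ cL int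
      with short-antipath hole antihole no-leap connY neY P 3≤L odd-L c₀ cL
             (λ 0<i i<L → X∩Y (int 0<i i<L) , missing (int 0<i i<L))
    ... | refl , Q , odd-Q = close₁ antihole Q (bX (int (s≤s z≤n) (s≤s (s≤s z≤n)))) (bX (int (s≤s z≤n) ≤-refl)) bY odd-Q

    -- The sides are to be `X ∪ C` and `Y ∪ F`. The interior of an odd path lies in X or in C, and
    -- its nonadjacent ends lie both in Y or both in F; paths through C are rerouted through X.
    module LooseParts (l : Loose D) (oneX : OneOrMissing D (Loose.X l) (Loose.Y l))
                      (oneY : OneOrMissing (swap D) (Loose.Y l) (Loose.X l))
                      {C F : Subset n} (C-apart : ∀ {v} → v ∈ C → Complete (swap D) (Loose.X l) v)
                      (C∩Y : ∀ {v} → v ∈ C → v ∉ Loose.Y l)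
                      (F-complete : ∀ {v} → v ∈ F → Complete D (Loose.Y l) v) (F∩X : ∀ {v} → v ∈ F → v ∉ Loose.X l)
                      where
      open Loose l

      PathFree : Subset n → Subset n → Set
      PathFree S T = ∀ {p L} → IndPath D p L → 3 ≤ L → odd L ≡ true → p 0 ∈ S → p L ∈ S →
                     (∀ {i} → 0 < i → i < L → p i ∈ T) → ⊥

      Y-X : PathFree Y X
      Y-X P 3≤L odd-L p₀ pL int = hole P (≤-trans (n≤1+n 2) 3≤L) (bY p₀) (bY pL) (λ 0<i i<L → bX (int 0<i i<L)) odd-L

      F-X : PathFree F X
      F-X P 3≤L odd-L p₀ pL int = crossing-path connY neY X∩Y bX bY oneX P 3≤L odd-L (F-complete p₀) (F-complete pL) int

      lifted : ∀ {S} → PathFree S X → (∀ {v} → v ∈ S → v ∉ X) →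
               OneOrMissing (swap D) S X → PathFree S C
      lifted free S∩X (inj₁ one) P 3≤L _ p₀ pL int = N⇒≢ (ends-apart P 3≤L) (one p₀ pL)
      lifted {S} free S∩X (inj₂ nb) P 3≤L odd-L p₀ pL int
        with via hole connX P 3≤L odd-L (S∩X p₀) (S∩X pL) (nb p₀) (nb pL) (λ 0<i i<L → C-apart (int 0<i i<L))
      ... | Q , odd-Q = free (Link.path Q) (odd-link≥3 Q odd-Q) odd-Q (subst (_∈ S) (sym (Link.start Q)) p₀)
                          (subst (_∈ S) (sym (Link.finish Q)) pL) (Link.interior Q)

      no-odd-path : OneOrMissing (swap D) F X →
                    NoOddPath D (X ∪ C) (Y ∪ F)
      no-odd-path oneF P 3≤L odd-L p₀ pL int
        with x∈p∪q⁻ Y F p₀ | x∈p∪q⁻ Y F pL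
           | one-side (λ x∈ c∈ → N-sym (C-apart c∈ x∈)) P (≤-trans (n≤1+n 2) 3≤L) (λ 0<i i<L → x∈p∪q⁻ X C (int 0<i i<L))
      ... | inj₁ y₀ | inj₁ yL | inj₁ inX = Y-X P 3≤L odd-L y₀ yL inX
      ... | inj₁ y₀ | inj₁ yL | inj₂ inC = lifted Y-X (λ y∈ x∈ → X∩Y x∈ y∈) oneY P 3≤L odd-L y₀ yL inC
      ... | inj₂ f₀ | inj₂ fL | inj₁ inX = F-X P 3≤L odd-L f₀ fL inX
      ... | inj₂ f₀ | inj₂ fL | inj₂ inC = lifted F-X F∩X oneF P 3≤L odd-L f₀ fL inC
      ... | inj₁ y₀ | inj₂ fL | _ = excl (F-complete fL y₀) (N-sym (ends-apart P 3≤L))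
      ... | inj₂ f₀ | inj₁ yL | _ = excl (F-complete f₀ yL) (ends-apart P 3≤L)

module _ {n : ℕ} {D : Duo n} (good : Good D) where
  open Duo D
  open IndPath
  open Good good

  module _ (l : Loose D) (oneX : OneOrMissing D (Loose.X l) (Loose.Y l))
           (oneY : OneOrMissing (swap D) (Loose.Y l) (Loose.X l)) where
    open Loose l

    b∉X : b ∉ X
    b∉X b∈ = N-irrefl (bX b∈)

    b∉Y : b ∉ Y
    b∉Y b∈ = E-irrefl (bY b∈)

    private
      assemble : ∀ {C F : Subset n} → (∀ v → v ∉ X → v ∉ Y → v ∈ C ⊎ v ∈ F) → (∀ {v} → v ∈ C → v ∉ F) →
        (∀ {v} → v ∈ C → Complete (swap D) X v × v ∉ Y) → (∀ {v} → v ∈ F → Complete D Y v × v ∉ X) →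
        ∃ (_∈ C) → ∃ (_∈ F) →
        OneOrMissing (swap D) F X →
        ∃₂ λ A B → SkewSplit D A B × NoOddPath D A B × NoOddPath (swap D) B A
      assemble {C} {F} cover disj C-facts F-facts (c₀ , c₀∈) (f₀ , f₀∈) oneF = X ∪ C , Y ∪ F , record
        { cover = λ v → case v ∈? X of λ
            { (yes v∈) → inj₁ (p⊆p∪q C v∈)
            ; (no v∉X) → case v ∈? Y of λ
              { (yes v∈) → inj₂ (p⊆p∪q F v∈)
              ; (no v∉Y) → Sum.map (q⊆p∪q X C) (q⊆p∪q Y F) (cover v v∉X v∉Y) } }
        ; disjoint = λ v∈A v∈B → apart (x∈p∪q⁻ X C v∈A) (x∈p∪q⁻ Y F v∈B)
        ; A-disc = proj₁ neX , c₀ , p⊆p∪q C (proj₂ neX) , q⊆p∪q X C c₀∈ , λ walk →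
            let u , v , _ , v∈A , u∈X , v∉X , e = crossing D X walk (proj₂ neX) (λ c∈X → N-irrefl (proj₁ (C-facts c₀∈) c∈X))
            in case x∈p∪q⁻ X C v∈A of λ
              { (inj₁ v∈X) → v∉X v∈X ; (inj₂ v∈C) → excl (E-sym e) (proj₁ (C-facts v∈C) u∈X) }
        ; B-disc = proj₁ neY , f₀ , p⊆p∪q F (proj₂ neY) , q⊆p∪q Y F f₀∈ , λ walk →
            let u , v , _ , v∈B , u∈Y , v∉Y , o = crossing (swap D) Y walk (proj₂ neY) (λ f∈Y → E-irrefl (proj₁ (F-facts f₀∈) f∈Y))
            in case x∈p∪q⁻ Y F v∈B of λ
              { (inj₁ v∈Y) → v∉Y v∈Y ; (inj₂ v∈F) → excl (proj₁ (F-facts v∈F) u∈Y) (N-sym o) } }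
        , LooseParts.no-odd-path good l oneX oneY (proj₁ ∘ C-facts) (proj₂ ∘ C-facts) (proj₁ ∘ F-facts) (proj₂ ∘ F-facts) oneF
        , no-odd-antipath
        where
        apart : ∀ {v} → v ∈ X ⊎ v ∈ C → v ∈ Y ⊎ v ∈ F → ⊥
        apart (inj₁ x) (inj₁ y) = X∩Y x y
        apart (inj₁ x) (inj₂ f) = proj₂ (F-facts f) x
        apart (inj₂ c) (inj₁ y) = proj₂ (C-facts c) y
        apart (inj₂ c) (inj₂ f) = disj c f
        module Co = LooseParts (swap-good good) (swap-loose l) oneY oneX {F} {C}
                      (proj₁ ∘ F-facts) (proj₂ ∘ F-facts) (proj₁ ∘ C-facts) (proj₂ ∘ C-facts)
        -- Rerouting through Y would need non-neighbours in Y for the vertices of C, which may be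
        -- absent. Instead X yields an odd path between the two middle vertices, both in F, which
        -- `F-X` forbids.
        C-F : OneOrMissing (swap D) F X → Co.PathFree C F
        C-F (inj₁ one) P 3≤L odd-L c₀ cL int = through-one P 3≤L int one
        C-F (inj₂ nb) {p} {L} P 3≤L odd-L c₀ cL int
          with short-antipath antihole hole no-coleap connX neX P 3≤L odd-L
                 (proj₁ (C-facts c₀)) (proj₁ (C-facts cL))
                 (λ 0<i i<L → proj₂ (F-facts (int 0<i i<L)) , nb (int 0<i i<L))
        ... | refl , Q , odd-Q = LooseParts.F-X good l oneX oneY {C} (proj₁ ∘ C-facts) (proj₂ ∘ C-facts)
                  (proj₁ ∘ F-facts) (proj₂ ∘ F-facts) (Link.path Q) (odd-link≥3 Q odd-Q) odd-Q
                  (subst (_∈ F) (sym (Link.start Q)) (int (s≤s z≤n) (s≤s (s≤s z≤n))))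
                  (subst (_∈ F) (sym (Link.finish Q)) (int (s≤s z≤n) ≤-refl)) (Link.interior Q)
        no-odd-antipath : NoOddPath (swap D) (Y ∪ F) (X ∪ C)
        no-odd-antipath P 3≤L odd-L p₀ pL int
          with x∈p∪q⁻ X C p₀ | x∈p∪q⁻ X C pL
             | one-side (λ y∈ f∈ → E-sym (proj₁ (F-facts f∈) y∈)) P (≤-trans (n≤1+n 2) 3≤L) (λ 0<i i<L → x∈p∪q⁻ Y F (int 0<i i<L))
        ... | inj₁ x₀ | inj₁ xL | inj₁ inY = Co.Y-X P 3≤L odd-L x₀ xL inY
        ... | inj₁ x₀ | inj₁ xL | inj₂ inF = Co.lifted Co.Y-X (λ x∈ y∈ → X∩Y x∈ y∈) oneX P 3≤L odd-L x₀ xL inF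
        ... | inj₂ c₀ | inj₂ cL | inj₁ inY = Co.F-X P 3≤L odd-L c₀ cL inY
        ... | inj₂ c₀ | inj₂ cL | inj₂ inF = C-F oneF P 3≤L odd-L c₀ cL inF
        ... | inj₁ x₀ | inj₂ cL | _ = excl (N⇐ P 3≤L) (N-sym (proj₁ (C-facts cL) x₀))
          where
          N⇐ : ∀ {p L} → IndPath (swap D) p L → 3 ≤ L → E (p 0) (p L)
          N⇐ = ends-apart
        ... | inj₂ c₀ | inj₁ xL | _ = excl (N⇐ P 3≤L) (proj₁ (C-facts c₀) xL)
          where
          N⇐ : ∀ {p L} → IndPath (swap D) p L → 3 ≤ L → E (p 0) (p L)
          N⇐ = ends-apart

    -- On the side of Y we put exactly the vertices with a neighbour in X, or b
    -- alone if there are none.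
    balance : ∃₂ λ A B → SkewSplit D A B × NoOddPath D A B × NoOddPath (swap D) B A
    balance with any? (λ v → ¬? (v ∈? X) ×-dec ¬? (v ∈? Y) ×-dec ¬? (complete? {D = swap D} X v))
    ... | yes (f , f∉X , f∉Y , ¬c) = assemble {⟪ C? ⟫} {⟪ F? ⟫}
        (λ v v∉X v∉Y → case complete? {D = swap D} X v of λ
          { (yes a) → inj₁ (∈⟪⟫⁺ C? (v∉X , v∉Y , a)) ; (no ¬a) → inj₂ (∈⟪⟫⁺ F? (v∉X , v∉Y , ¬a)) })
        (λ v∈C v∈F → proj₂ (proj₂ (∈⟪⟫⁻ F? v∈F)) (proj₂ (proj₂ (∈⟪⟫⁻ C? v∈C))))
        (λ v∈C → let _ , v∉Y , a = ∈⟪⟫⁻ C? v∈C in a , v∉Y)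
        (λ v∈F → let v∉X , v∉Y , ¬a = ∈⟪⟫⁻ F? v∈F in
          (case other v∉X v∉Y of λ { (inj₁ a) → ⊥-elim (¬a a) ; (inj₂ c) → c }) , v∉X)
        (b , ∈⟪⟫⁺ C? (b∉X , b∉Y , bX)) (f , ∈⟪⟫⁺ F? (f∉X , f∉Y , ¬c))
        (inj₂ λ v∈F → let v∉X , _ , ¬a = ∈⟪⟫⁻ F? v∈F in non-neighbour {D = swap D} v∉X ¬a)
        where
        C? : ∀ v → Dec (v ∉ X × v ∉ Y × Complete (swap D) X v)
        C? v = ¬? (v ∈? X) ×-dec ¬? (v ∈? Y) ×-dec complete? {D = swap D} X v
        F? : ∀ v → Dec (v ∉ X × v ∉ Y × ¬ Complete (swap D) X v)
        F? v = ¬? (v ∈? X) ×-dec ¬? (v ∈? Y) ×-dec ¬? (complete? {D = swap D} X v)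
    ... | no none = assemble {⟪ C? ⟫} {⁅ b ⁆}
        (λ v v∉X v∉Y → case v ≟ᶠ b of λ
          { (yes refl) → inj₂ (x∈⁅x⁆ b) ; (no v≢b) → inj₁ (∈⟪⟫⁺ C? (v∉X , v∉Y , v≢b)) })
        (λ v∈C v∈b → proj₂ (proj₂ (∈⟪⟫⁻ C? v∈C)) (x∈⁅y⁆⇒x≡y b v∈b))
        (λ {v} v∈C → let v∉X , v∉Y , _ = ∈⟪⟫⁻ C? v∈C in
          (case complete? {D = swap D} X v of λ
            { (yes a) → a ; (no ¬a) → ⊥-elim (none (v , v∉X , v∉Y , ¬a)) }) , v∉Y)
        (λ v∈b → subst (λ v → Complete D Y v × v ∉ X) (sym (x∈⁅y⁆⇒x≡y b v∈b)) (bY , b∉X))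
        -- As b now joins Y, it is c that keeps the side of X disconnected.
        (c , ∈⟪⟫⁺ C? (c∉X , c∉Y , c≢b)) (b , x∈⁅x⁆ b)
        (inj₁ λ s∈ s′∈ → trans (x∈⁅y⁆⇒x≡y b s∈) (sym (x∈⁅y⁆⇒x≡y b s′∈)))
        where
        C? : ∀ v → Dec (v ∉ X × v ∉ Y × v ≢ b)
        C? v = ¬? (v ∈? X) ×-dec ¬? (v ∈? Y) ×-dec ¬? (v ≟ᶠ b)

size : ∀ {n} {D : Duo n} → Loose D → ℕ
size l = ∣ Loose.X l ∣ + ∣ Loose.Y l ∣

-- A vertex u of Y without neighbours in X may leave Y, being anticomplete to X. An anticomponent of
-- what is left replaces Y, and the discarded vertices other than u are complete to it.
shrink : ∀ {n} {D : Duo n} (l : Loose D) →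
         (∃ λ l′ → size {D = D} l′ < size l) ⊎ OneOrMissing (swap D) (Loose.Y l) (Loose.X l)
shrink {D = D} l with any? (λ u → any? (λ w → (u ∈? Y) ×-dec (w ∈? Y) ×-dec ¬? (w ≟ᶠ u) ×-dec complete? {D = swap D} X u))
  where open Loose l
... | yes (u , w , u∈ , w∈ , w≢u , a) = inj₁ (record
    { connX = connX ; connY = conn ; neX = neX ; neY = w , root ; X∩Y = λ x∈ k∈ → X∩Y x∈ (K⊆Y k∈)
    ; bX = bX ; bY = bY ∘ K⊆Y ; c∉X = c∉X ; c∉Y = c∉Y ∘ K⊆Y ; c≢b = c≢b
    ; other = other′ }
  , +-monoʳ-< ∣ X ∣ (p⊂q⇒∣p∣<∣q∣ (K⊆Y , u , u∈ , λ u∈K → proj₂ (∈∖⁻ (within u∈K)) refl)))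
  where
  open Duo D
  open Loose l
  open Component (component (swap D) (Y ∖ u) (∈∖⁺ w∈ w≢u))
  K⊆Y : K ⊆ Y
  K⊆Y = proj₁ ∘ ∈∖⁻ ∘ within
  other′ : ∀ {v} → v ∉ X → v ∉ K → Complete (swap D) X v ⊎ Complete D K v
  other′ {v} v∉X v∉K with v ∈? Y | v ≟ᶠ u
  ... | yes _   | yes refl = inj₁ a
  ... | yes v∈Y | no v≢u   = inj₂ λ k∈ → E-sym (closed k∈ (∈∖⁺ v∈Y v≢u) v∉K)
  ... | no v∉Y  | _ with other v∉X v∉Y
  ...   | inj₁ a = inj₁ a
  ...   | inj₂ c = inj₂ λ k∈ → c (K⊆Y k∈)
... | no none with any? (λ u → any? (λ w → (u ∈? Loose.Y l) ×-dec (w ∈? Loose.Y l) ×-dec ¬? (w ≟ᶠ u)))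
...   | no none′ = inj₂ (inj₁ λ {y} {y′} y∈ y′∈ → case y ≟ᶠ y′ of λ
          { (yes eq) → eq ; (no y≢) → ⊥-elim (none′ (y′ , y , y′∈ , y∈ , y≢)) })
...   | yes (u , w , u∈ , w∈ , w≢u) = inj₂ (inj₂ λ {y} y∈ → non-neighbour {D = swap D} (λ y∈X → Loose.X∩Y l y∈X y∈)
          λ a → case y ≟ᶠ u of λ
            { (yes refl) → none (u , w , u∈ , w∈ , w≢u , a)
            ; (no y≢u) → none (y , u , y∈ , u∈ , (λ eq → y≢u (sym eq)) , a) })

loose⇒balanced : ∀ {n} {D : Duo n} → Good D → (l : Loose D) → Acc _<_ (size l) →
                 ∃₂ λ A B → SkewSplit D A B × NoOddPath D A B × NoOddPath (swap D) B A
loose⇒balanced {D = D} good l (acc rs) with shrink l | shrink (swap-loose l)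
... | inj₁ (l′ , lt) | _ = loose⇒balanced good l′ (rs lt)
... | inj₂ _ | inj₁ (l′ , lt) = loose⇒balanced good (swap-loose l′)
  (rs (subst₂ _<_ (+-comm ∣ Loose.X l′ ∣ _) (+-comm ∣ Loose.Y l ∣ _) lt))
... | inj₂ oneY | inj₂ oneX = balance good l oneX oneY

-- Skew partitions that are not loose

-- The first subdivision shifts the old vertices by one, so the edge opposite to 01 is then 34. The
-- result is the complete bipartite graph with parts 0, 2, 3 and 1, 4, 5 minus the edge 01.
K₄-two-subdivided : Graph 6
K₄-two-subdivided = subdivideEdge (subdivideEdge (completeGraph 4) 0F 1F ((λ ()) , inj₁ tt))
                                  3F 4F ((λ ()) , inj₁ (((λ ()) , inj₁ tt) , (λ { (() , _) }) , λ { (() , _) }))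

subdivision : SubdivisionOf (completeGraph 4) K₄-two-subdivided
subdivision = subdivide (subdivide unsubdivided 0F 1F _) 3F 4F _

bipartite : Bipartite K₄-two-subdivided
bipartite = lookup side , λ {x} {y} → from-yes
    (all? λ x → all? λ y → (x ∼? y) →-dec ¬? (lookup side x Bool.≟ lookup side y)) x y
  where
  open Graph K₄-two-subdivided
  side : Vec Bool 6
  side = false ∷ true ∷ false ∷ false ∷ true ∷ true ∷ []

L⟨K₄⟩ : Graph 8
L⟨K₄⟩ = lineGraph K₄-two-subdivided

record Free {n : ℕ} (D : Duo n) : Set where
  field
    good        : Good D
    no-DD       : ∀ f → ¬ Induces D doubleDiamond f
    no-L⟨K₄⟩    : ∀ f → ¬ Induces D L⟨K₄⟩ f
    no-co-L⟨K₄⟩ : ∀ f → ¬ Induces (swap D) L⟨K₄⟩ f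

-- The complement of the double diamond is a double diamond.
relabel : Vec (Fin 8) 8
relabel = 2F ∷ 3F ∷ 4F ∷ 5F ∷ 7F ∷ 6F ∷ 1F ∷ 0F ∷ []

swap-free : ∀ {n} {D : Duo n} → Free D → Free (swap D)
swap-free {n} {D} free = record
  { good = swap-good good ; no-L⟨K₄⟩ = no-co-L⟨K₄⟩ ; no-co-L⟨K₄⟩ = no-L⟨K₄⟩
  ; no-DD = λ f ind → no-DD (f ∘ π) record
    { edge = λ {i} {j} e → let πi≢πj , ¬e = to-non-edge i j e in Induces.non-edge ind πi≢πj ¬e
    ; non-edge = λ {i} {j} i≢j ¬e → Induces.edge ind (to-edge i j i≢j ¬e) } }
  where
  open Free free
  open Graph doubleDiamond
  π : Fin 8 → Fin 8
  π = lookup relabel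
  to-non-edge : ∀ i j → i ∼ j → π i ≢ π j × ¬ (π i ∼ π j)
  to-non-edge = from-yes (all? λ i → all? λ j → (i ∼? j) →-dec (¬? (π i ≟ᶠ π j) ×-dec ¬? (π i ∼? π j)))
  to-edge : ∀ i j → i ≢ j → ¬ (i ∼ j) → π i ∼ π j
  to-edge = from-yes (all? λ i → all? λ j → ¬? (i ≟ᶠ j) →-dec (¬? (i ∼? j) →-dec (π i ∼? π j)))

module _ {n : ℕ} {D : Duo n} where
  open Duo D
  open IndPath

  E⊎N : ∀ {x y} → x ≢ y → E x y ⊎ N x y
  E⊎N {x} {y} x≢y with E? x y
  ... | yes e = inj₁ e
  ... | no ¬e = inj₂ (¬E⇒N x≢y ¬e)

  three-link : ∀ {S u v} (Q : Link D S u v) → Link.L Q ≡ 3 → ∃₂ λ c d → c ∈ S × d ∈ S ×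
               E u c × E c d × E d v × N u d × N c v
  three-link record { p = p ; path = P ; start = refl ; finish = refl ; interior = int } refl =
    p 1 , p 2 , int (s≤s z≤n) (s≤s (s≤s z≤n)) , int (s≤s z≤n) ≤-refl ,
    step P (s≤s z≤n) , step P (s≤s (s≤s z≤n)) , step P ≤-refl , far P ≤-refl (s≤s (s≤s z≤n)) , far P ≤-refl ≤-refl

module _ {n : ℕ} {D : Duo n} where
  open Duo D
  open IndPath

  -- Neither c nor d sees both x and y, and neither x nor y misses both c and d, by five-holes. So c
  -- and d attach to x and y in one of two crosswise ways: as a and b do, which gives the double
  -- diamond, or in the opposite way, which gives the line graph.
  double-diamond⊎L⟨K₄⟩ : Free D → ∀ {u v a b c d x y} →
    E u a → E a b → E b v → N u b → N a v → N u v →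
    E u c → E c d → E d v → N u d → N c v →
    N a c → N a d → N b c → N b d →
    E u x → E u y → E v x → E v y → N x y →
    N a x → E a y → E b x → N b y →
    c ≢ x → c ≢ y → d ≢ x → d ≢ y → ⊥
  double-diamond⊎L⟨K₄⟩ free {u} {v} {a} {b} {c} {d} {x} {y}
    ua ab bv ub av uv uc cd dv ud cv ac ad bc bd ux uy vx vy xy ax ay bx by c≢x c≢y d≢x d≢y
    with E⊎N {D = D} c≢x | E⊎N {D = D} c≢y | E⊎N {D = D} d≢x | E⊎N {D = D} d≢y
  ... | inj₁ cx | inj₁ cy | _ | _ = no-five-hole (Good.hole (Free.good free)) (E-sym bx) (E-sym ab) ay (E-sym cy) cx
                                     (N-sym ax) xy by (N-sym bc) (N-sym ac)
  ... | _ | _ | inj₁ dx | inj₁ dy = no-five-hole (Good.hole (Free.good free)) (E-sym bx) (E-sym ab) ay (E-sym dy) dx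
                                     (N-sym ax) xy by (N-sym bd) (N-sym ad)
  ... | inj₂ cx | _ | inj₂ dx | _ = no-five-hole (Good.hole (Free.good free)) uc cd dv vx (E-sym ux) ud uv cv (N-sym cx) (N-sym dx)
  ... | _ | inj₂ cy | _ | inj₂ dy = no-five-hole (Good.hole (Free.good free)) uc cd dv vy (E-sym uy) ud uv cv (N-sym cy) (N-sym dy)
  ... | inj₂ cx | inj₁ cy | inj₁ dx | inj₂ dy = Free.no-DD free _ (triangle⇒induces D doubleDiamond
    (lookup (u ∷ y ∷ a ∷ c ∷ x ∷ v ∷ b ∷ d ∷ []))
    ( (λ { 0F → uy ; 1F → ua ; 2F → uc ; 3F → ux ; 4F → uv ; 5F → ub ; 6F → ud })
    , (λ { 0F → E-sym ay ; 1F → E-sym cy ; 2F → N-sym xy ; 3F → E-sym vy ; 4F → N-sym by ; 5F → N-sym dy })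
    , (λ { 0F → ac ; 1F → ax ; 2F → av ; 3F → ab ; 4F → ad })
    , (λ { 0F → cx ; 1F → cv ; 2F → N-sym bc ; 3F → cd })
    , (λ { 0F → E-sym vx ; 1F → E-sym bx ; 2F → E-sym dx })
    , (λ { 0F → E-sym bv ; 1F → E-sym dv })
    , (λ { 0F → bd })
    , (λ ()) , tt))
  ... | inj₁ cx | inj₂ cy | inj₂ dx | inj₁ dy = Free.no-L⟨K₄⟩ free _ (triangle⇒induces D L⟨K₄⟩
    -- These stand for the edges 04, 05, 12, 13, 24, 25, 34, 35 in the order of `edges`; the pairs
    -- c, d and a, b are the two halves of the subdivided edges.
    (lookup (c ∷ d ∷ a ∷ b ∷ u ∷ y ∷ x ∷ v ∷ []))
    ( (λ { 0F → cd ; 1F → N-sym ac ; 2F → N-sym bc ; 3F → E-sym uc ; 4F → cy ; 5F → cx ; 6F → cv })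
    , (λ { 0F → N-sym ad ; 1F → N-sym bd ; 2F → N-sym ud ; 3F → dy ; 4F → dx ; 5F → dv })
    , (λ { 0F → ab ; 1F → E-sym ua ; 2F → ay ; 3F → ax ; 4F → av })
    , (λ { 0F → N-sym ub ; 1F → by ; 2F → bx ; 3F → bv })
    , (λ { 0F → uy ; 1F → ux ; 2F → uv })
    , (λ { 0F → N-sym xy ; 1F → E-sym vy })
    , (λ { 0F → E-sym vx })
    , (λ ()) , tt))

  no-odd-path-across : Free D → ∀ {A₂ B₂ p L} → Conn D A₂ → Conn (swap D) B₂ → ∃ (_∈ A₂) → ∃ (_∈ B₂) →
    IndPath D p L → 3 ≤ L → odd L ≡ true →
    Complete D B₂ (p 0) → Complete D B₂ (p L) →
    (∀ {i} → 0 < i → i < L → p i ∉ B₂ × ∃ λ y → y ∈ B₂ × N (p i) y) →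
    p 0 ∉ A₂ → p L ∉ A₂ → ∃ (λ x → x ∈ A₂ × E (p 0) x) → ∃ (λ x → x ∈ A₂ × E (p L) x) →
    (∀ {i} → 0 < i → i < L → Complete (swap D) A₂ (p i)) →
    (∀ {a} → a ∈ A₂ → a ∉ B₂ × ∃ λ y → y ∈ B₂ × N a y) →
    (∀ {b} → b ∈ B₂ → ∃ λ x → x ∈ A₂ × E b x) → ⊥
  no-odd-path-across free {A₂} {B₂} {p} {L} connA connB neA neB P 3≤L odd-L c₀ cL int p₀∉ pL∉ nb₀ nbL apart missA nbB
    with short-antipath hole antihole no-leap connB neB P 3≤L odd-L c₀ cL int
       | via hole connA P 3≤L odd-L p₀∉ pL∉ nb₀ nbL apart
    where open Good (Free.good free)
  ... | refl , R , odd-R | Q , odd-Q = finish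
    where
    open Good (Free.good free)
    Q≡3 : Link.L Q ≡ 3
    Q≡3 = proj₁ (short-antipath hole antihole no-leap connB neB (Link.path Q) (odd-link≥3 Q odd-Q) odd-Q
      (λ {y} → subst (Complete D B₂) (sym (Link.start Q)) c₀ {y})
      (λ {y} → subst (Complete D B₂) (sym (Link.finish Q)) cL {y})
      (λ 0<i i<M → missA (Link.interior Q 0<i i<M)))
    R≡3 : Link.L R ≡ 3
    R≡3 = proj₁ (short-antipath antihole hole no-coleap connA neA (Link.path R) (odd-link≥3 R odd-R) odd-R
      (λ {y} → subst (Complete (swap D) A₂) (sym (Link.start R)) (apart (s≤s z≤n) (s≤s (s≤s z≤n))) {y})
      (λ {y} → subst (Complete (swap D) A₂) (sym (Link.finish R)) (apart (s≤s z≤n) ≤-refl) {y})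
      (λ 0<i i<M → (λ y∈A → proj₁ (missA y∈A) (Link.interior R 0<i i<M)) , nbB (Link.interior R 0<i i<M)))
    finish : ⊥
    finish with three-link {D = D} Q Q≡3 | three-link {D = swap D} R R≡3
    ... | c , d , c∈ , d∈ , uc , cd , dv , ud , cv | x , y , x∈ , y∈ , ax , xy , yb , ay , xb =
      double-diamond⊎L⟨K₄⟩ free
        (step P (s≤s z≤n)) (step P (s≤s (s≤s z≤n))) (step P ≤-refl)
        (far P {0} {2} ≤-refl (s≤s (s≤s z≤n))) (far P {1} {3} ≤-refl ≤-refl) (ends-apart P 3≤L)
        uc cd dv ud cv
        (apart (s≤s z≤n) (s≤s (s≤s z≤n)) c∈) (apart (s≤s z≤n) (s≤s (s≤s z≤n)) d∈)
        (apart (s≤s z≤n) ≤-refl c∈) (apart (s≤s z≤n) ≤-refl d∈)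
        (c₀ x∈) (c₀ y∈) (cL x∈) (cL y∈) xy ax ay (E-sym xb) (N-sym yb)
        (A≢B c∈ x∈) (A≢B c∈ y∈) (A≢B d∈ x∈) (A≢B d∈ y∈)
      where
      A≢B : ∀ {s t} → s ∈ A₂ → t ∈ B₂ → s ≢ t
      A≢B s∈ t∈ refl = proj₁ (missA s∈) t∈

module _ {n : ℕ} {D : Duo n} where
  open Duo D

  disjoint-component : ∀ {X r w v} (C : Component D X r) (C′ : Component D X w) →
    w ∉ Component.K C → v ∈ Component.K C′ → v ∉ Component.K C
  disjoint-component C C′ w∉ v∈ v∈C
    with crossing D (Component.K C) (Component.conn C′ v∈ (Component.root C′)) v∈C w∉
  ... | _ , _ , _ , t∈ , s∈C , t∉C , e = excl e (Component.closed C s∈C (Component.within C′ t∈) t∉C)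

  vertex-outside : ∀ {X r} → (∃₂ λ s t → s ∈ X × t ∈ X × ¬ Walk D X s t) → (C : Component D X r) →
    ∃ λ w → w ∈ X × w ∉ Component.K C
  vertex-outside (s , t , s∈ , t∈ , ¬walk) C with s ∈? Component.K C | t ∈? Component.K C
  ... | no s∉  | _      = s , s∈ , s∉
  ... | yes _  | no t∉  = t , t∈ , t∉
  ... | yes s∈C | yes t∈C = contradiction (Walk-mono D (Component.within C) (Component.conn C s∈C t∈C)) ¬walk

flip-split : ∀ {n} {D : Duo n} {A B} → SkewSplit D A B → SkewSplit (swap D) B A
flip-split sp = record
  { cover = Sum.swap ∘ cover ; disjoint = λ v∈B v∈A → disjoint v∈A v∈B ; A-disc = B-disc ; B-disc = A-disc }
  where open SkewSplit sp

-- The condition is vacuous outside A, so that `all⊎any` can range over all vertices.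
Attached : ∀ {n} (D : Duo n) (A B : Subset n) → Fin n → Set
Attached D A B a = a ∈ A → Σ (Component D A a) λ C → ∀ {b} → b ∈ B → ∃ λ s → s ∈ Component.K C × Duo.E D b s

Unattached : ∀ {n} (D : Duo n) (A B : Subset n) → Fin n → Set
Unattached D A B a = Σ (Component D A a) λ C → ∃ λ b → b ∈ B × Complete (swap D) (Component.K C) b

attached⊎unattached : ∀ {n} (D : Duo n) {A B} → SkewSplit D A B →
                      (∀ a → Attached D A B a) ⊎ ∃ (Unattached D A B)
attached⊎unattached D {A} {B} sp = all⊎any decide
  where
  decide : ∀ a → Attached D A B a ⊎ Unattached D A B a
  decide a with a ∈? A
  ... | no a∉ = inj₁ λ a∈ → contradiction a∈ a∉
  ... | yes a∈ with component D A a∈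
  ...   | C with any? (λ b → (b ∈? B) ×-dec complete? {D = swap D} (Component.K C) b)
  ...     | yes (b , b∈ , c) = inj₂ (C , b , b∈ , c)
  ...     | no none = inj₁ λ _ → C , λ b∈ → non-neighbour {D = swap D}
              (λ b∈K → SkewSplit.disjoint sp (Component.within C b∈K) b∈) λ c → none (_ , b∈ , c)

unattached⇒loose : ∀ {n} {D : Duo n} {A B} → SkewSplit D A B → ∃ (Unattached D A B) → Loose D
unattached⇒loose {D = D} {A} {B} sp (a , C , b , b∈ , bX)
  with component (swap D) B b∈
... | Cb with vertex-outside {D = D} (SkewSplit.A-disc sp) C | vertex-outside {D = swap D} (SkewSplit.B-disc sp) Cb
...   | c , c∈A , c∉C | w , w∈B , w∉ = record
  { connX = conn C ; connY = conn Cw ; neX = a , root C ; neY = w , root Cw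
  ; X∩Y = λ x∈ y∈ → disjoint (within C x∈) (within Cw y∈) ; bX = bX
  ; bY = λ y∈ → E-sym (closed Cw y∈ b∈ λ b∈Cw → disjoint-component {D = swap D} Cb Cw w∉ b∈Cw (root Cb))
  ; c∉X = c∉C ; c∉Y = λ c∈ → disjoint c∈A (within Cw c∈) ; c≢b = λ { refl → disjoint c∈A b∈ }
  ; other = other }
  where
  open Duo D
  open Component
  open SkewSplit sp
  Cw = component (swap D) B w∈B
  other : ∀ {v} → v ∉ K C → v ∉ K Cw → Complete (swap D) (K C) v ⊎ Complete D (K Cw) v
  other {v} v∉C v∉Cw with cover v
  ... | inj₁ v∈A = inj₁ λ x∈ → N-sym (closed C x∈ v∈A v∉C)
  ... | inj₂ v∈B = inj₂ λ y∈ → E-sym (closed Cw y∈ v∈B v∉Cw)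

-- The interior of P stays in one component of A and its nonadjacent ends in one anticomponent of B;
-- a further component and a further anticomponent provide the sets for `no-odd-path-across`.
attached⇒no-odd-path : ∀ {n} {D : Duo n} {A B} → Free D → SkewSplit D A B →
  (∀ a → Attached D A B a) → (∀ b → Attached (swap D) B A b) → NoOddPath D A B
attached⇒no-odd-path {D = D} {A} {B} free sp attA attB {p} {L} P 3≤L odd-L p₀∈ pL∈ int =
  no-odd-path-across free (conn C₂) (conn M₂) (_ , root C₂) (_ , root M₂) P 3≤L odd-L
    (complete-M₂ (root M₁)) (complete-M₂ pL∈M₁)
    (λ 0<i i<L → (λ p∈ → disjoint (int 0<i i<L) (within M₂ p∈)) , proj₂ (attB w w∈) (int 0<i i<L))
    (λ p∈ → disjoint (within C₂ p∈) p₀∈) (λ p∈ → disjoint (within C₂ p∈) pL∈)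
    (proj₂ (attA z z∈) p₀∈) (proj₂ (attA z z∈) pL∈)
    (λ 0<i i<L x∈ → closed C₁ (in-C₁ 0<i i<L) (within C₂ x∈) (disjoint-component {D = D} C₁ C₂ z∉ x∈))
    (λ x∈ → (λ y∈ → disjoint (within C₂ x∈) (within M₂ y∈)) , proj₂ (attB w w∈) (within C₂ x∈))
    (λ y∈ → proj₂ (attA z z∈) (within M₂ y∈))
  where
  open Duo D
  open Component
  open SkewSplit sp
  p₁∈ : p 1 ∈ A
  p₁∈ = int (s≤s z≤n) (≤-trans (s≤s (s≤s z≤n)) 3≤L)
  C₁ : Component D A (p 1)
  C₁ = component D A p₁∈
  M₁ : Component (swap D) B (p 0)
  M₁ = component (swap D) B p₀∈
  outside-C₁ = vertex-outside {D = D} A-disc C₁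
  z = proj₁ outside-C₁
  z∈ = proj₁ (proj₂ outside-C₁)
  z∉ = proj₂ (proj₂ outside-C₁)
  outside-M₁ = vertex-outside {D = swap D} B-disc M₁
  w = proj₁ outside-M₁
  w∈ = proj₁ (proj₂ outside-M₁)
  w∉ = proj₂ (proj₂ outside-M₁)
  C₂ : Component D A z
  C₂ = proj₁ (attA z z∈)
  M₂ : Component (swap D) B w
  M₂ = proj₁ (attB w w∈)
  pL∈M₁ : p L ∈ K M₁
  pL∈M₁ with p L ∈? K M₁
  ... | yes p∈ = p∈
  ... | no p∉  = contradiction (ends-apart {D = D} P 3≤L) (excl (closed M₁ (root M₁) pL∈ p∉))
  complete-M₂ : ∀ {v} → v ∈ K M₁ → Complete D (K M₂) v
  complete-M₂ v∈ y∈ = closed M₁ v∈ (within M₂ y∈) (disjoint-component {D = swap D} M₁ M₂ w∉ y∈)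
  in-C₁ : ∀ {i} → 0 < i → i < L → p i ∈ K C₁
  in-C₁ {suc i} _ = from-1 i
    where
    from-1 : ∀ i → suc i < L → p (suc i) ∈ K C₁
    from-1 zero    _   = root C₁
    from-1 (suc i) i<L with p (suc (suc i)) ∈? K C₁
    ... | yes p∈ = p∈
    ... | no p∉  = contradiction (closed C₁ (from-1 i (<⇒≤ i<L)) (int (s≤s z≤n) i<L) p∉)
                     (excl (IndPath.step P (<⇒≤ i<L)))

-- Translation from graphs

duo : ∀ {n} → Graph n → Duo n
duo G = record
  { E = _∼_ ; N = Graph._∼_ (complement G) ; E-sym = ∼-sym ; N-sym = Graph.∼-sym (complement G)
  ; E-irrefl = ∼-irrefl refl ; N-irrefl = Graph.∼-irrefl (complement G) refl
  ; excl = λ e (_ , ¬e) → ¬e e ; E? = _∼?_ ; N? = Graph._∼?_ (complement G)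
  ; total = λ x≢y ¬e ¬o → ¬o (x≢y , ¬e) }
  where open Graph G

even⇒2∣ : ∀ k → odd k ≡ false → Even k
even⇒2∣ zero          _  = 2 ∣0
even⇒2∣ (suc zero)    ()
even⇒2∣ (suc (suc k)) eq = ∣m∣n⇒∣m+n ∣-refl (even⇒2∣ k (trans (sym (not-involutive (odd k))) eq))

2∣⇒even : ∀ k → Even k → odd k ≡ false
2∣⇒even zero          _   = refl
2∣⇒even (suc zero)    2∣1 with ∣1⇒≡1 2∣1
... | ()
2∣⇒even (suc (suc k)) 2∣k = cong (not ∘ not) (2∣⇒even k (∣m+n∣m⇒∣n 2∣k ∣-refl))

odd⇒≡true : ∀ k → Odd k → odd k ≡ true
odd⇒≡true k ¬2∣k with odd k in eq
... | true  = refl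
... | false = contradiction (even⇒2∣ k eq) ¬2∣k

-- Here D is not fixed as `duo H`: for the complement of G the pair needed is `swap (duo G)`, whose
-- non-adjacency is that of G rather than a twofold complement.
module _ {n : ℕ} (H : Graph n) (D : Duo n)
         (to : ∀ {x y} → Duo.E D x y → Graph._∼_ H x y) (from : ∀ {x y} → Graph._∼_ H x y → Duo.E D x y) where
  open Duo D

  induces⇒⊑ : ∀ {k} {K : Graph k} {f} → Induces D K f → K ⊑ H
  induces⇒⊑ {K = K} {f} ind = record
    { embed = f
    ; injective = λ {i} {j} eq → case i ≟ᶠ j of λ
        { (yes i≡j) → i≡j
        ; (no i≢j) → case Graph._∼?_ K i j of λ
          { (yes e) → contradiction eq (E⇒≢ (edge e))
          ; (no ¬e) → contradiction eq (N⇒≢ (non-edge i≢j ¬e)) } }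
    ; adjacency = λ i j → mk⇔ (to ∘ edge) λ h → case Graph._∼?_ K i j of λ
        { (yes e) → e
        ; (no ¬e) → case i ≟ᶠ j of λ
          { (yes refl) → contradiction (from h) E-irrefl
          ; (no i≢j) → contradiction (non-edge i≢j ¬e) (excl (from h)) } } }
    where open Induces ind

  ⊑⇒induces : ∀ {k} {K : Graph k} (emb : K ⊑ H) → Induces D K (_⊑_.embed emb)
  ⊑⇒induces emb = record
    { edge = λ {i} {j} e → from (Equivalence.to (adjacency i j) e)
    ; non-edge = λ {i} {j} i≢j ¬e → ¬E⇒N (i≢j ∘ injective) (¬e ∘ Equivalence.from (adjacency i j) ∘ to) }
    where open _⊑_ emb

  path-induces : ∀ {p L} → IndPath D p L → Induces D (pathGraph L) (p ∘ toℕ)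
  path-induces {p} {L} P = record
    { edge = λ { {i} {j} (_ , inj₁ eq) → next eq (toℕ≤pred[n] j)
               ; {i} {j} (_ , inj₂ eq) → E-sym (next eq (toℕ≤pred[n] i)) }
    ; non-edge = λ {i} {j} i≢j ¬e → case <-cmp (toℕ i) (toℕ j) of λ
        { (tri< i<j _ _) → apart i<j (toℕ≤pred[n] j) λ eq → ¬e (i≢j , inj₁ eq)
        ; (tri≈ _ eq _) → contradiction (toℕ-injective eq) i≢j
        ; (tri> _ _ j<i) → N-sym (apart j<i (toℕ≤pred[n] i) λ eq → ¬e (i≢j , inj₂ eq)) } }
    where
    open IndPath P
    next : ∀ {i j} → j ≡ suc i → j ≤ L → E (p i) (p j)
    next refl = step
    apart : ∀ {i j} → i < j → j ≤ L → j ≢ suc i → N (p i) (p j)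
    apart i<j j≤L j≢ = far (≤∧≢⇒< i<j (j≢ ∘ sym)) j≤L

  cycle-induces : ∀ {p L v} → IndPath D p L → E v (p 0) → E v (p L) →
    (∀ {i} → 0 < i → i < L → N v (p i)) → Induces D (cycleGraph (2 + L)) λ { zero → v ; (suc i) → p (toℕ i) }
  cycle-induces {p} {L} {v} P v₀ vL vN = record
    { edge = λ
      { {zero}  {zero}  (0≢0 , _) → contradiction refl 0≢0
      ; {zero}  {suc j} (_ , r) → spoke j r
      ; {suc i} {zero}  (_ , r) → E-sym (spoke i (Sum.swap r))
      ; {suc i} {suc j} (i≢j , r) → Induces.edge (path-induces P) (i≢j ∘ cong suc , Sum.map rim rim r) }
    ; non-edge = λ
      { {zero}  {zero}  0≢0 _ → contradiction refl 0≢0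
      ; {zero}  {suc j} _ ¬e → non-spoke j λ r → ¬e ((λ ()) , r)
      ; {suc i} {zero}  _ ¬e → N-sym (non-spoke i λ r → ¬e ((λ ()) , Sum.swap r))
      ; {suc i} {suc j} i≢j ¬e → Induces.non-edge (path-induces P) (i≢j ∘ cong suc)
          λ (_ , r) → ¬e (i≢j , Sum.map (inj₁ ∘ cong suc) (inj₁ ∘ cong suc) r) } }
    where
    Next : ℕ → ℕ → Set
    Next i j = j ≡ suc i ⊎ (j ≡ 0 × suc i ≡ 2 + L)
    rim : ∀ {i j} → Next (suc i) (suc j) → j ≡ suc i
    rim (inj₁ refl) = refl
    spoke : ∀ (j : Fin (suc L)) → Next 0 (suc (toℕ j)) ⊎ Next (suc (toℕ j)) 0 → E v (p (toℕ j))
    spoke j (inj₁ (inj₁ eq)) = subst (E v ∘ p) (sym (suc-injective eq)) v₀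
    spoke j (inj₂ (inj₂ (_ , eq))) = subst (E v ∘ p) (sym (suc-injective (suc-injective eq))) vL
    non-spoke : ∀ (j : Fin (suc L)) → ¬ (Next 0 (suc (toℕ j)) ⊎ Next (suc (toℕ j)) 0) → N v (p (toℕ j))
    non-spoke j ¬r = vN (n≢0⇒n>0 λ eq → ¬r (inj₁ (inj₁ (cong suc eq))))
      (≤∧≢⇒< (toℕ≤pred[n] j) λ eq → ¬r (inj₂ (inj₂ (refl , cong (2 +_) eq))))

  even-holes⇒OddHoleFree : (∀ (C : Hole H) → Even (Hole.len C)) → OddHoleFree D
  even-holes⇒OddHoleFree even {p} {L} P 2≤L v₀ vL vN odd-L = contradiction
    (trans (sym (cong (not ∘ not) odd-L)) (2∣⇒even (2 + L) (even record
      { len = 2 + L ; 4≤len = s≤s (s≤s 2≤L) ; cycle = induces⇒⊑ (cycle-induces P v₀ vL vN) })))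
    λ ()

  path-of : ∀ {p L} → IndPath D p L → Path H (p 0) (p L)
  path-of {p} {L} P = record
    { len = L ; path = induces⇒⊑ (path-induces P) ; start = refl ; finish = cong p (toℕ-fromℕ L) }

  -- The triangles are x, `p 0`, `p 1` and `p L`, y, `p (L - 1)`. Two of the joining paths are the
  -- single edges from x to `p L` and from `p 0` to y; the long one is the interior of the leap
  -- path.
  no-long-prism⇒NoLeap : ¬ LongPrism H → NoLeap D
  no-long-prism⇒NoLeap no-prism {p} {suc K} {x} {y} P (s≤s 3≤K) xy x₀ x₁ xL xN y₀ yK yL yN =
    no-prism (prism , 2F , ≤-trans (s≤s (s≤s z≤n)) 3≤K)
    where
    open IndPath P
    L = suc (suc K)
    a b : Fin 3 → Fin n
    a = λ { 0F → x   ; 1F → p 0 ; 2F → p 1 }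
    b = λ { 0F → p L ; 1F → y   ; 2F → p (suc K) }
    side : ∀ i → Path H (a i) (b i)
    side 0F = path-of (path₁ {D = D} xL)
    side 1F = path-of (path₁ {D = D} (E-sym y₀))
    side 2F = path-of (shift P 1 (n≤1+n (suc K)))
    -- Both alternatives imply distinctness, so this covers `disjoint` and `only-edges` at once; its
    -- symmetry leaves three pairs to check.
    Separate : Fin 3 → Fin 3 → Fin n → Fin n → Set
    Separate i j u v = (E u v × ((u ≡ a i × v ≡ a j) ⊎ (u ≡ b i × v ≡ b j))) ⊎ N u v
    Separate-sym : ∀ {i j u v} → Separate i j u v → Separate j i v u
    Separate-sym = Sum.map (λ (e , r) → E-sym e , Sum.map (λ (s , t) → t , s) (λ (s , t) → t , s) r) N-sym
    0<L : 0 < L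
    0<L = s≤s z≤n
    01-separate : ∀ s t → Separate 0F 1F (Path.vertex (side 0F) s) (Path.vertex (side 1F) t)
    01-separate 0F 0F = inj₁ (x₀ , inj₁ (refl , refl))
    01-separate 0F 1F = inj₂ xy
    01-separate 1F 0F = inj₂ (N-sym (far (s≤s (s≤s z≤n)) ≤-refl))
    01-separate 1F 1F = inj₁ (E-sym yL , inj₂ (refl , refl))
    02-separate : ∀ s t → Separate 0F 2F (Path.vertex (side 0F) s) (Path.vertex (side 2F) t)
    02-separate 0F zero    = inj₁ (x₁ , inj₁ (refl , refl))
    02-separate 0F (suc t) = inj₂ (xN (s≤s (s≤s z≤n)) (s≤s (toℕ≤pred[n] (suc t))))
    02-separate 1F t with m≤n⇒m<n∨m≡n (toℕ≤pred[n] t)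
    ... | inj₁ t<K = inj₂ (N-sym (far (s≤s (s≤s t<K)) ≤-refl))
    ... | inj₂ eq  = inj₁ (subst (E (p L) ∘ p ∘ suc) (sym eq) (E-sym (step ≤-refl)) , inj₂ (refl , cong (p ∘ suc) eq))
    12-separate : ∀ s t → Separate 1F 2F (Path.vertex (side 1F) s) (Path.vertex (side 2F) t)
    12-separate 0F zero    = inj₁ (step 0<L , inj₁ (refl , refl))
    12-separate 0F (suc t) = inj₂ (far (s≤s (s≤s z≤n)) (m≤n⇒m≤1+n (s≤s (toℕ≤pred[n] (suc t)))))
    12-separate 1F t with m≤n⇒m<n∨m≡n (toℕ≤pred[n] t)
    ... | inj₁ t<K = inj₂ (yN (s≤s z≤n) (s≤s t<K))
    ... | inj₂ eq  = inj₁ (subst (E y ∘ p ∘ suc) (sym eq) yK , inj₂ (refl , cong (p ∘ suc) eq))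
    separate : ∀ {i j} → i ≢ j → ∀ s t → Separate i j (Path.vertex (side i) s) (Path.vertex (side j) t)
    separate {0F} {0F} i≢j = contradiction refl i≢j
    separate {1F} {1F} i≢j = contradiction refl i≢j
    separate {2F} {2F} i≢j = contradiction refl i≢j
    separate {0F} {1F} _ s t = 01-separate s t
    separate {0F} {2F} _ s t = 02-separate s t
    separate {1F} {2F} _ s t = 12-separate s t
    separate {1F} {0F} _ s t = Separate-sym {0F} {1F} (01-separate t s)
    separate {2F} {0F} _ s t = Separate-sym {0F} {2F} (02-separate t s)
    separate {2F} {1F} _ s t = Separate-sym {1F} {2F} (12-separate t s)
    triangle : ∀ (c : Fin 3 → Fin n) → E (c 0F) (c 1F) → E (c 0F) (c 2F) → E (c 1F) (c 2F) →
               ∀ {i j} → i ≢ j → Graph._∼_ H (c i) (c j)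
    triangle c e₀₁ e₀₂ e₁₂ {0F} {0F} i≢j = contradiction refl i≢j
    triangle c e₀₁ e₀₂ e₁₂ {1F} {1F} i≢j = contradiction refl i≢j
    triangle c e₀₁ e₀₂ e₁₂ {2F} {2F} i≢j = contradiction refl i≢j
    triangle c e₀₁ e₀₂ e₁₂ {0F} {1F} _ = to e₀₁
    triangle c e₀₁ e₀₂ e₁₂ {0F} {2F} _ = to e₀₂
    triangle c e₀₁ e₀₂ e₁₂ {1F} {2F} _ = to e₁₂
    triangle c e₀₁ e₀₂ e₁₂ {1F} {0F} _ = to (E-sym e₀₁)
    triangle c e₀₁ e₀₂ e₁₂ {2F} {0F} _ = to (E-sym e₀₂)
    triangle c e₀₁ e₀₂ e₁₂ {2F} {1F} _ = to (E-sym e₁₂)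
    corners : ∀ i j → a i ≢ b j
    corners 0F 0F = E⇒≢ xL
    corners 0F 1F = N⇒≢ xy
    corners 0F 2F = N⇒≢ (xN (s≤s (≤-trans (s≤s z≤n) 3≤K)) ≤-refl)
    corners 1F 0F = N⇒≢ (far (s≤s (s≤s z≤n)) ≤-refl)
    corners 1F 1F = E⇒≢ (E-sym y₀)
    corners 1F 2F = N⇒≢ (far (s≤s (≤-trans (s≤s z≤n) 3≤K)) (n≤1+n (suc K)))
    corners 2F 0F = N⇒≢ (far (s≤s (s≤s (≤-trans (s≤s z≤n) 3≤K))) ≤-refl)
    corners 2F 1F = N⇒≢ (N-sym (yN (s≤s z≤n) (s≤s (≤-trans (s≤s z≤n) 3≤K))))
    corners 2F 2F = N⇒≢ (far (s≤s (≤-trans (s≤s (s≤s z≤n)) 3≤K)) (n≤1+n (suc K)))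
    prism : Prism H
    prism = record
      { a = a ; b = b ; P = side
      ; triangle-a = triangle a x₀ x₁ (step 0<L)
      ; triangle-b = triangle b (E-sym yL) (E-sym (step ≤-refl)) yK
      ; a≢b = corners
      ; disjoint = λ i≢j s t → [ E⇒≢ ∘ proj₁ , N⇒≢ ]′ (separate i≢j s t)
      ; only-edges = λ i≢j s t h → [ proj₂ , (λ o → contradiction o (excl (from h))) ]′ (separate i≢j s t) }

  -- Indices beyond k are sent to the last vertex, where an `IndPath` ignores them.
  at : ∀ k → ℕ → Fin (suc k)
  at k       zero    = zero
  at zero    (suc i) = zero
  at (suc k) (suc i) = suc (at k i)

  toℕ-at : ∀ k {i} → i ≤ k → toℕ (at k i) ≡ i
  toℕ-at k       z≤n       = refl
  toℕ-at (suc k) (s≤s i≤k) = cong suc (toℕ-at k i≤k)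

  at-last : ∀ k → at k k ≡ fromℕ k
  at-last zero    = refl
  at-last (suc k) = cong suc (at-last k)

  path⇒IndPath : ∀ {u v} (P : Path H u v) → IndPath D (Path.vertex P ∘ at (Path.len P)) (Path.len P)
  path⇒IndPath P = record
    { step = λ {i} i<len → edge
        ( (λ eq → 1+n≢n (trans (sym (toℕ-at len i<len)) (trans (sym (cong toℕ eq)) (toℕ-at len (<⇒≤ i<len)))))
        , inj₁ (trans (toℕ-at len i<len) (cong suc (sym (toℕ-at len (<⇒≤ i<len))))))
    ; far = λ {i} {j} si<j j≤len →
        let i≤len = ≤-trans (<⇒≤ (<⇒≤ si<j)) j≤len ; i≡ = toℕ-at len i≤len ; j≡ = toℕ-at len j≤len in
        non-edge (λ eq → <⇒≢ (<⇒≤ si<j) (trans (sym i≡) (trans (cong toℕ eq) j≡)))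
          λ { (_ , inj₁ eq) → <⇒≢ si<j (trans (cong suc (sym i≡)) (trans (sym eq) j≡))
            ; (_ , inj₂ eq) → <⇒≱ si<j (≤-trans (n≤1+n j) (≤-trans (≤-reflexive (trans (cong suc (sym j≡)) (trans (sym eq) i≡))) (n≤1+n i))) } }
    where
    open Path P
    open Induces (⊑⇒induces path)

  NoOddPath⇒ : ∀ {A B} → NoOddPath D A B → ∀ {u v} → u ∈ B → v ∈ B → ¬ Graph._∼_ H u v →
               (P : Path H u v) → Path.InteriorIn P A → ¬ Odd (Path.len P)
  NoOddPath⇒ {A} {B} no-odd {u} {v} u∈ v∈ ¬uv P int ¬2∣ = no-odd ind (3≤len ind refl (odd⇒≡true len ¬2∣)) (odd⇒≡true len ¬2∣)
    (subst (_∈ B) (sym start) u∈) (subst (_∈ B) (sym last) v∈)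
    λ {i} 0<i i<len → int (at len i)
      (λ eq → <⇒≢ 0<i (sym (trans (sym (toℕ-at len (<⇒≤ i<len))) (cong toℕ eq))))
      (λ eq → <⇒≢ i<len (trans (sym (toℕ-at len (<⇒≤ i<len))) (trans (cong toℕ eq) (toℕ-fromℕ len))))
    where
    open Path P
    ind : IndPath D (vertex ∘ at len) len
    ind = path⇒IndPath P
    last : vertex (at len len) ≡ v
    last = trans (cong vertex (at-last len)) finish
    -- Length 1 would make u and v adjacent. The separate L can be matched on while the vertex
    -- function keeps `len`.
    3≤len : ∀ {L} → IndPath D (vertex ∘ at len) L → len ≡ L → odd L ≡ true → 3 ≤ L
    3≤len {1} Q eq _ = contradiction
      (subst₂ (Graph._∼_ H) start (trans (cong (vertex ∘ at len) (sym eq)) last) (to (IndPath.step Q (s≤s z≤n)))) ¬uv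
    3≤len {suc (suc (suc _))} _ _ _ = s≤s (s≤s (s≤s z≤n))

theorem15p1 : (n : ℕ) (G : Graph n) → F₆ G →
    (∃₂ λ A B → SkewPartition G A B) →
    (∃₂ λ A B → SkewPartition G A B × Balanced G A B)
theorem15p1 n G f₆ (A , B , sp) = let A′ , B′ , split′ , no-path , no-antipath = result in
  A′ , B′ , record
    { cover = ⊆-antisym (⊆-max _) λ {v} _ → x∈p∪q⁺ (SkewSplit.cover split′ v)
    ; disjoint = Empty-unique λ (v , v∈) → let v∈A , v∈B = x∈p∩q⁻ A′ B′ v∈ in SkewSplit.disjoint split′ v∈A v∈B
    ; A-disconnected = SkewSplit.A-disc split′ ; B-disconnected = SkewSplit.B-disc split′ }
  , record
    { no-odd-path = NoOddPath⇒ G D id id no-path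
    ; no-odd-antipath = λ u∈ v∈ uv → NoOddPath⇒ (complement G) (swap D) id id no-antipath u∈ v∈ λ o → proj₂ o uv }
  where
  open F₆ f₆
  open F₅ f₅
  D = duo G
  free : Free D
  free = record
    { good = record
      { hole = even-holes⇒OddHoleFree G D id id (proj₁ berge)
      ; antihole = even-holes⇒OddHoleFree (complement G) (swap D) id id (proj₂ berge)
      ; no-leap = no-long-prism⇒NoLeap G D id id (proj₁ no-long-prism)
      ; no-coleap = no-long-prism⇒NoLeap (complement G) (swap D) id id (proj₂ no-long-prism) }
    ; no-DD = λ _ → no-double-diamond ∘ induces⇒⊑ G D id id
    ; no-L⟨K₄⟩ = λ _ → proj₁ (no-L⟨K₄⟩ K₄-two-subdivided subdivision bipartite) ∘ induces⇒⊑ G D id id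
    ; no-co-L⟨K₄⟩ = λ _ → proj₂ (no-L⟨K₄⟩ K₄-two-subdivided subdivision bipartite)
                           ∘ induces⇒⊑ (complement G) (swap D) id id }
  split : SkewSplit D A B
  split = record
    { cover = λ v → x∈p∪q⁻ A B (subst (v ∈_) (sym (SkewPartition.cover sp)) ∈⊤)
    ; disjoint = λ v∈A v∈B → ∉⊥ (subst (_ ∈_) (SkewPartition.disjoint sp) (x∈p∩q⁺ (v∈A , v∈B)))
    ; A-disc = SkewPartition.A-disconnected sp ; B-disc = SkewPartition.B-disconnected sp }
  result : ∃₂ λ A B → SkewSplit D A B × NoOddPath D A B × NoOddPath (swap D) B A
  result with attached⊎unattached D split | attached⊎unattached (swap D) (flip-split split)
  ... | inj₂ un | _ = loose⇒balanced (Free.good free) (unattached⇒loose split un) (<-wellFounded _)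
  ... | inj₁ _  | inj₂ un = loose⇒balanced (Free.good free)
    (swap-loose (unattached⇒loose (flip-split split) un)) (<-wellFounded _)
  ... | inj₁ attA | inj₁ attB = A , B , split , attached⇒no-odd-path free split attA attB
                              , attached⇒no-odd-path (swap-free free) (flip-split split) attB attA
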